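{- Let $H$ be the graph on vertex set $\{0,1,2,3\}$ with red edge set $\{\{0,2\}\}$ and blue edge set $\{\{0,1\},\{0,3\},\{1,3\}\}$. Then $\lambda_H=1/8$, and this value is attained asymptotically by complete bipartite graphs of order $n\to\infty$ with both parts of size $(1/2+o(1))n$. Moreover, if $(G_n)$ is a sequence of graphs with orders tending to infinity and $\lambda_H(G_n)\to\lambda_H$, and $F$ is a $5$-vertex graph whose induced density $p(F,G_n)$ is bounded below by a positive constant for all large $n$, then $F$ is complete bipartite or is obtained from a $4$-vertex complete bipartite graph by adding one isolated vertex.
   Context: All graphs are finite and simple; the order of a graph is its number of vertices. For a graph $H$ with $\kappa$ vertices whose edges are coloured red or blue and an uncoloured graph $G$ of order $n\ge\kappa$, an embedding of $H$ into $G$ is an injection $V(H)\to V(G)$ that maps red edges of $H$ to edges of $G$ and blue edges of $H$ to non-edges of $G$ (pairs of distinct non-adjacent vertices). $\Lambda_H(G)$ is the number of embeddings, $\lambda_H(G):=\Lambda_H(G)/\big(n(n-1)\cdots(n-\kappa+1)\big)$, $\lambda_H(n)$ is the maximum of $\lambda_H(G)$ over all graphs $G$ of order $n$, and $\lambda_H:=\lim_{n\to\infty}\lambda_H(n)$ (the limit exists). For a graph $F$ with $k$ vertices and a graph $G$ of order $n\ge k$, $p(F,G)$ is the number of $k$-subsets of $V(G)$ inducing a subgraph isomorphic to $F$, divided by $\binom nk$. A complete bipartite graph is a blowup of $K_2$: its vertex set is split into two parts, one of which may be empty, and two vertices are adjacent if and only if they are in different parts (so an edgeless graph counts as complete bipartite).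 -}

module Defs where

open import Data.Bool using (Bool; true; false; _xor_)
open import Data.Bool.Properties using () renaming (_≟_ to _≟ᵇ_)
open import Data.Fin using (Fin; zero; suc)
open import Data.Fin.Patterns using (0F; 1F; 2F; 3F)
open import Data.Fin.Permutation using (Permutation′; _⟨$⟩ʳ_)
open import Data.Fin.Properties using (_≟_; all?; any?)
open import Data.Fin.Subset using (Subset; ∣_∣; _∈_)
open import Data.Fin.Subset.Properties using (_∈?_)
open import Data.Integer using (+_)
open import Data.List using (List; []; _∷_; allFin; cartesianProductWith; filter; length)
import Data.List.Membership.Propositional as List
open import Data.List.Membership.Propositional.Properties using (∈-allFin; ∈-cartesianProductWith⁺)
import Data.List.Relation.Unary.Any as Any
open import Data.Nat using (ℕ; zero; suc; _≤_)
open import Data.Nat.Combinatorics using (_P_; _C_)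
import Data.Nat.Properties as ℕ
open import Data.Product using (Σ; ∃; ∃-syntax; _×_; _,_; uncurry)
open import Data.Rational as ℚ using (ℚ; 0ℚ)
open import Data.Vec using (Vec; []; _∷_; lookup)
open import Function using (Injective)
open import Relation.Binary.PropositionalEquality using (_≡_; refl)
open import Relation.Nullary using (Dec; ¬_)
open import Relation.Nullary.Decidable using (map′; from-yes; ¬?; _×-dec_; _→-dec_)
open import Relation.Unary using (Decidable)

private
  variable
    k κ n : ℕ

record Graph (n : ℕ) : Set where
  field
    adj    : Fin n → Fin n → Bool
    sym    : ∀ u v → adj u v ≡ adj v u
    irrefl : ∀ u → adj u u ≡ false

open Graph public

_≅_ : Graph n → Graph n → Set
_≅_ {n} F G = Σ (Permutation′ n) λ π →
  ∀ u v → adj F u v ≡ adj G (π ⟨$⟩ʳ u) (π ⟨$⟩ʳ v)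

-- The complete bipartite graph with parts A and its complement; as A is
-- arbitrary, either part may be empty.
IsBipartition : Graph n → Subset n → Set
IsBipartition G A = ∀ u v → adj G u v ≡ lookup A u xor lookup A v

CompleteBipartite : Graph n → Set
CompleteBipartite {n} G = Σ (Subset n) (IsBipartition G)

-- The new, isolated vertex is `zero`.
addIsolated : Graph n → Graph (suc n)
addIsolated {n} G = record { adj = adj⁺ ; sym = sym⁺ ; irrefl = irrefl⁺ }
  where
  adj⁺ : Fin (suc n) → Fin (suc n) → Bool
  adj⁺ (suc u) (suc v) = adj G u v
  adj⁺ zero    _       = false
  adj⁺ (suc _) zero    = false

  sym⁺ : ∀ u v → adj⁺ u v ≡ adj⁺ v u
  sym⁺ zero    zero    = refl
  sym⁺ zero    (suc _) = refl
  sym⁺ (suc _) zero    = refl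
  sym⁺ (suc u) (suc v) = sym G u v

  irrefl⁺ : ∀ u → adj⁺ u u ≡ false
  irrefl⁺ zero    = refl
  irrefl⁺ (suc u) = irrefl G u

-- Pairs of vertices that are neither red nor blue are uncoloured non-edges.
record ColouredGraph (κ : ℕ) : Set where
  field
    red      : Graph κ
    blue     : Graph κ
    disjoint : ∀ i j → ¬ (adj red i j ≡ true × adj blue i j ≡ true)

open ColouredGraph public

vectors : ∀ {A : Set} → List A → (k : ℕ) → List (Vec A k)
vectors xs zero    = [] ∷ []
vectors xs (suc k) = cartesianProductWith _∷_ xs (vectors xs k)

∈-vectors : ∀ {A : Set} {xs : List A} → (∀ x → x List.∈ xs) →
            (v : Vec A k) → v List.∈ vectors xs k
∈-vectors all []      = Any.here refl
∈-vectors all (x ∷ v) = ∈-cartesianProductWith⁺ _∷_ (all x) (∈-vectors all v)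

tuples : (n k : ℕ) → List (Vec (Fin n) k)
tuples n k = vectors (allFin n) k

subsets : (n : ℕ) → List (Subset n)
subsets n = vectors (false ∷ true ∷ []) n

anyTuple? : ∀ {P : Vec (Fin n) k → Set} → Decidable P → Dec (∃ P)
anyTuple? {n} {k} P? =
  map′ Any.satisfied (uncurry λ v p → List.lose (∈-vectors ∈-allFin v) p)
       (Any.any? P? (tuples n k))

Inj : Vec (Fin n) k → Set
Inj φ = Injective _≡_ _≡_ (lookup φ)

inj? : (φ : Vec (Fin n) k) → Dec (Inj φ)
inj? φ = map′ (λ f {i} {j} → f i j) (λ f i j → f {i} {j})
  (all? λ i → all? λ j → (lookup φ i ≟ lookup φ j) →-dec (i ≟ j))

-- Quotients by 0 are set to 0.  The denominators below vanish only for
-- graphs whose order is too small for the density to be defined (or is 0),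
-- so this does not affect limits as the order tends to infinity.
_÷_ : ℕ → ℕ → ℚ
a ÷ zero  = 0ℚ
a ÷ suc b = (+ a) ℚ./ suc b

-- A map Fin κ → Fin n is represented by its vector of values.  A blue edge
-- joins distinct vertices, so by injectivity its image is a non-edge rather
-- than a single vertex.
IsEmbedding : ColouredGraph κ → Graph n → Vec (Fin n) κ → Set
IsEmbedding H G φ =
  Inj φ
  × (∀ i j → adj (red H)  i j ≡ true → adj G (lookup φ i) (lookup φ j) ≡ true)
  × (∀ i j → adj (blue H) i j ≡ true → adj G (lookup φ i) (lookup φ j) ≡ false)

isEmbedding? : (H : ColouredGraph κ) (G : Graph n) → Decidable (IsEmbedding H G)
isEmbedding? H G φ =
  inj? φ
  ×-dec (all? λ i → all? λ j → (adj (red H)  i j ≟ᵇ true) →-dec (_ ≟ᵇ true))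
  ×-dec (all? λ i → all? λ j → (adj (blue H) i j ≟ᵇ true) →-dec (_ ≟ᵇ false))

Λ : ColouredGraph κ → Graph n → ℕ
Λ {κ} {n} H G = length (filter (isEmbedding? H G) (tuples n κ))

density : ColouredGraph κ → Graph n → ℚ
density {κ} {n} H G = Λ H G ÷ (n P κ)

-- φ is an isomorphism from F onto the subgraph of G induced by S.
IsInducedCopy : Graph k → Graph n → Subset n → Vec (Fin n) k → Set
IsInducedCopy F G S φ =
  Inj φ
  × (∀ i → lookup φ i ∈ S)
  × (∀ v → v ∈ S → ∃[ i ] lookup φ i ≡ v)
  × (∀ i j → adj F i j ≡ adj G (lookup φ i) (lookup φ j))

Induces : Graph k → Graph n → Subset n → Set
Induces {k} F G S = ∣ S ∣ ≡ k × ∃ (IsInducedCopy F G S)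

induces? : (F : Graph k) (G : Graph n) → Decidable (Induces F G)
induces? {k} F G S = (∣ S ∣ ℕ.≟ k) ×-dec anyTuple? λ φ →
  inj? φ
  ×-dec (all? λ i → lookup φ i ∈? S)
  ×-dec (all? λ v → (v ∈? S) →-dec any? λ i → lookup φ i ≟ v)
  ×-dec (all? λ i → all? λ j → adj F i j ≟ᵇ _)

p : Graph k → Graph n → ℚ
p {k} {n} F G = length (filter (induces? F G) (subsets n)) ÷ (n C k)

infix 4 _⟶_ _⟶∞

_⟶_ : (ℕ → ℚ) → ℚ → Set
a ⟶ ℓ = ∀ ε → 0ℚ ℚ.< ε → ∃[ N ] (∀ m → N ≤ m → ℚ.∣ a m ℚ.- ℓ ∣ ℚ.< ε)

_⟶∞ : (ℕ → ℕ) → Set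
a ⟶∞ = ∀ M → ∃[ N ] (∀ m → N ≤ m → M ≤ a m)

-- For rational sequences, positive real and positive rational lower bounds
-- are interchangeable.
EventuallyBoundedBelow : (ℕ → ℚ) → Set
EventuallyBoundedBelow a =
  ∃[ c ] (0ℚ ℚ.< c × ∃[ N ] (∀ m → N ≤ m → c ℚ.≤ a m))

IsMaxDensity : ColouredGraph κ → ℕ → ℚ → Set
IsMaxDensity H n q =
  Σ (Graph n) (λ G → density H G ≡ q) × (∀ (G : Graph n) → density H G ℚ.≤ q)

IsLimitDensity : ColouredGraph κ → ℚ → Set
IsLimitDensity H ℓ =
  Σ (ℕ → ℚ) λ max → (∀ n → IsMaxDensity H n (max n)) × (max ⟶ ℓ)

redAdj : Fin 4 → Fin 4 → Bool
redAdj 0F 2F = true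
redAdj 2F 0F = true
redAdj _  _  = false

blueAdj : Fin 4 → Fin 4 → Bool
blueAdj 0F 1F = true
blueAdj 1F 0F = true
blueAdj 0F 3F = true
blueAdj 3F 0F = true
blueAdj 1F 3F = true
blueAdj 3F 1F = true
blueAdj _  _  = false

H : ColouredGraph 4
H = record
  { red = record
      { adj    = redAdj
      ; sym    = from-yes (all? λ u → all? λ v → redAdj u v ≟ᵇ redAdj v u)
      ; irrefl = from-yes (all? λ u → redAdj u u ≟ᵇ false)
      }
  ; blue = record
      { adj    = blueAdj
      ; sym    = from-yes (all? λ u → all? λ v → blueAdj u v ≟ᵇ blueAdj v u)
      ; irrefl = from-yes (all? λ u → blueAdj u u ≟ᵇ false)
      }
  ; disjoint = from-yes (all? λ i → all? λ j →
      ¬? ((redAdj i j ≟ᵇ true) ×-dec (blueAdj i j ≟ᵇ true)))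
  }

{-# OPTIONS --safe #-}

-- Embeddings are the injective ones among the tuples (a, b, c, d) with a ~ c and
-- a, b, d pairwise non-adjacent, so the number of these copies is Λ + O(n³).  The
-- upper bound is a flag-algebra certificate on five vertices: the weight
--
--   16 (1 − 8 copy(a,b,c,d)) − rooted(a;b,c) rooted(a;d,e)
--     − 16 pairWeight(a,b,c) difference(a,b,c;d) difference(a,b,c;e),
--
-- symmetrised over the 120 orders of the vertices, is non-negative on every graph
-- of order 5, and at least 1 on those which the theorem does not list.  Its sum
-- over all 5-tuples is at most 16 n (n⁴ − 8 Σ copy), since the subtracted terms add
-- up to non-negative multiples of squares.  Tuples with repetitions need no separate
-- treatment, as equal vertices behave like non-adjacent twins.  Hence at most
-- 1920 n (n⁴ − 8 Λ) sets of vertices induce a graph F which is not listed, which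
-- gives both λ ≤ 1/8 and the vanishing of the density of F.  For a complete bipartite
-- graph with parts of sizes x and y, 8 Σ copy = (x + y)⁴ − (x − y)⁴.

module Submission where

open import Defs
open import Data.Fin.Subset using (Subset; ∣_∣; ∁)
open import Data.Integer using (+_)
open import Data.Nat using (ℕ)
open import Data.Product using (Σ; _×_)
open import Data.Rational using (ℚ; _/_; ½)
open import Data.Sum using (_⊎_)

open import Algebra.Properties.CommutativeSemigroup using (interchange)
open import Data.Bool using (Bool; true; false; not; _∧_; _xor_; if_then_else_)
open import Data.Bool.Properties using (xor-comm; xor-same) renaming (_≟_ to _≟ᵇ_)
open import Data.Fin using (Fin; zero; suc)
open import Data.Fin.Patterns using (0F; 1F; 2F; 3F; 4F)
open import Data.Fin.Permutation using (_⟨$⟩ʳ_; transpose)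
open import Data.Fin.Properties using (all?; any?; _≟_)
open import Data.Fin.Subset using (⊥)
open import Data.Fin.Subset.Properties using (_∈?_; anySubset?; ∣∁p∣≡n∸∣p∣; ∣p∣≤n)
open import Data.Integer as ℤ using (ℤ; -[1+_]; 0ℤ; 1ℤ; +≤+)
import Data.Integer.Properties as ℤ
open import Data.List
  using (List; []; _∷_; [_]; _++_; allFin; cartesianProductWith; filter; length; map)
import Data.List as List
open import Data.List.Membership.Propositional using () renaming (_∈_ to _∈ˡ_)
open import Data.List.Membership.Propositional.Properties
  using (∈-allFin; ∈-cartesianProductWith⁺)
open import Data.List.Properties using (filter-≐; length-tabulate; map-tabulate)
open import Data.List.Relation.Unary.All as All using (All)
open import Data.List.Relation.Unary.Any using (here; there)
open import Data.Nat as ℕ using (zero; suc; z≤n; s≤s)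
import Data.Nat.Properties as ℕ
open import Data.List.Extrema ℕ.≤-totalOrder using (argmax; f[xs]≤f[argmax])
open import Data.Product as Product using (∃; _,_; proj₁; proj₂)
open import Data.Sum as Sum using (inj₁; inj₂)
open import Data.Vec using (Vec; []; _∷_; lookup; tabulate)
open import Data.Vec.Properties
  using ([]=⇒lookup; lookup⇒[]=; lookup-map; lookup∘tabulate; tabulate-cong; tabulate∘lookup; ≡-dec)
open import Data.Vec.Relation.Unary.All using ([]; _∷_)
open import Data.Vec.Relation.Unary.AllPairs using ([]; _∷_)
open import Data.Vec.Relation.Unary.Unique.Propositional using (Unique)
open import Data.Vec.Relation.Unary.Unique.Propositional.Properties using (lookup-injective)
open import Function using (_∘_; case_of_; id)
open import Relation.Binary.PropositionalEquality as ≡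
  using (_≡_; _≢_; ≢-sym; refl; trans; cong; cong₂; subst; subst₂; module ≡-Reasoning)
open import Relation.Nullary using (¬_; Dec; yes; no; does; _because_; contradiction)
open import Relation.Nullary.Decidable using (dec-true; from-yes; ¬?; _×-dec_; _⊎-dec_; _→-dec_)
open import Relation.Unary using (Decidable)

private
  variable
    k κ n : ℕ
    V W Y : Set

module _ where

  open import Data.Integer using (_+_; _-_; -_; _*_; _≤_; _≤?_)
  open import Data.Integer.Tactic.RingSolver using (solve-∀)

  -- Finite sums

  ∑ : List V → (V → ℤ) → ℤ
  ∑ []       f = 0ℤ
  ∑ (x ∷ xs) f = f x + ∑ xs f

  ∑-cong : (xs : List V) {f g : V → ℤ} → (∀ x → f x ≡ g x) → ∑ xs f ≡ ∑ xs g
  ∑-cong []       f≗g = refl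
  ∑-cong (x ∷ xs) f≗g = cong₂ _+_ (f≗g x) (∑-cong xs f≗g)

  ∑-mono : (xs : List V) {f g : V → ℤ} → (∀ x → f x ≤ g x) → ∑ xs f ≤ ∑ xs g
  ∑-mono []       f≤g = ℤ.≤-refl
  ∑-mono (x ∷ xs) f≤g = ℤ.+-mono-≤ (f≤g x) (∑-mono xs f≤g)

  ∑-const : (xs : List V) (c : ℤ) → ∑ xs (λ _ → c) ≡ + length xs * c
  ∑-const []       c = ≡.sym (ℤ.*-zeroˡ c)
  ∑-const (x ∷ xs) c = trans (cong (_+_ c) (∑-const xs c)) (≡.sym (ℤ.suc-* (+ length xs) c))

  ∑-nonneg : (xs : List V) {f : V → ℤ} → (∀ x → 0ℤ ≤ f x) → 0ℤ ≤ ∑ xs f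
  ∑-nonneg []       0≤f = ℤ.≤-refl
  ∑-nonneg (x ∷ xs) 0≤f = ℤ.+-mono-≤ (0≤f x) (∑-nonneg xs 0≤f)

  ∑-+ : (xs : List V) (f g : V → ℤ) → ∑ xs (λ x → f x + g x) ≡ ∑ xs f + ∑ xs g
  ∑-+ []       f g = refl
  ∑-+ (x ∷ xs) f g = trans (cong (_+_ (f x + g x)) (∑-+ xs f g))
    (interchange ℤ.+-commutativeSemigroup (f x) (g x) _ _)

  ∑-*ˡ : (xs : List V) (c : ℤ) (f : V → ℤ) → ∑ xs (λ x → c * f x) ≡ c * ∑ xs f
  ∑-*ˡ []       c f = ≡.sym (ℤ.*-zeroʳ c)
  ∑-*ˡ (x ∷ xs) c f = trans (cong (_+_ (c * f x)) (∑-*ˡ xs c f))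
    (≡.sym (ℤ.*-distribˡ-+ c (f x) (∑ xs f)))

  ∑-*ʳ : (xs : List V) (f : V → ℤ) (c : ℤ) → ∑ xs (λ x → f x * c) ≡ ∑ xs f * c
  ∑-*ʳ xs f c = begin
    ∑ xs (λ x → f x * c) ≡⟨ ∑-cong xs (λ x → ℤ.*-comm (f x) c) ⟩
    ∑ xs (λ x → c * f x) ≡⟨ ∑-*ˡ xs c f ⟩
    c * ∑ xs f           ≡⟨ ℤ.*-comm c _ ⟩
    ∑ xs f * c           ∎
    where open ≡-Reasoning

  ∑-* : (xs : List V) (ys : List W) (f : V → ℤ) (g : W → ℤ) →
        ∑ xs (λ x → ∑ ys λ y → f x * g y) ≡ ∑ xs f * ∑ ys g
  ∑-* xs ys f g = trans (∑-cong xs λ x → ∑-*ˡ ys (f x) g) (∑-*ʳ xs f (∑ ys g))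

  ∑-swap : (xs : List V) (ys : List W) (f : V → W → ℤ) →
           ∑ xs (λ x → ∑ ys λ y → f x y) ≡ ∑ ys (λ y → ∑ xs λ x → f x y)
  ∑-swap []       ys f = ≡.sym (trans (∑-const ys 0ℤ) (ℤ.*-zeroʳ (+ length ys)))
  ∑-swap (x ∷ xs) ys f = trans (cong (_+_ (∑ ys (f x))) (∑-swap xs ys f)) (≡.sym (∑-+ ys (f x) _))

  ∑-++ : (xs ys : List V) (f : V → ℤ) → ∑ (xs ++ ys) f ≡ ∑ xs f + ∑ ys f
  ∑-++ []       ys f = ≡.sym (ℤ.+-identityˡ _)
  ∑-++ (x ∷ xs) ys f = trans (cong (_+_ (f x)) (∑-++ xs ys f)) (≡.sym (ℤ.+-assoc (f x) _ _))

  ∑-map : (h : V → W) (xs : List V) (f : W → ℤ) → ∑ (map h xs) f ≡ ∑ xs (f ∘ h)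
  ∑-map h []       f = refl
  ∑-map h (x ∷ xs) f = cong (_+_ (f (h x))) (∑-map h xs f)

  ∑-cartesianProductWith :
    (h : V → W → Y) (xs : List V) (ys : List W) (f : Y → ℤ) →
    ∑ (cartesianProductWith h xs ys) f ≡ ∑ xs λ x → ∑ ys λ y → f (h x y)
  ∑-cartesianProductWith h []       ys f = refl
  ∑-cartesianProductWith h (x ∷ xs) ys f =
    trans (∑-++ (map (h x) ys) _ f)
          (cong₂ _+_ (∑-map (h x) ys f) (∑-cartesianProductWith h xs ys f))

  ⟦_⟧ : Bool → ℤ
  ⟦ true  ⟧ = 1ℤ
  ⟦ false ⟧ = 0ℤ

  0≤⟦_⟧ : ∀ b → 0ℤ ≤ ⟦ b ⟧
  0≤⟦ true  ⟧ = +≤+ z≤n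
  0≤⟦ false ⟧ = +≤+ z≤n

  ⟦does⟧≤ : {P : Set} (P? : Dec P) {x : ℤ} → 0ℤ ≤ x → (P → 1ℤ ≤ x) → ⟦ does P? ⟧ ≤ x
  ⟦does⟧≤ (yes p) 0≤x 1≤x = 1≤x p
  ⟦does⟧≤ (no ¬p) 0≤x 1≤x = 0≤x

  length-filter : {P : V → Set} (P? : Decidable P) (xs : List V) →
                  + length (filter P? xs) ≡ ∑ xs λ x → ⟦ does (P? x) ⟧
  length-filter P? []       = refl
  length-filter P? (x ∷ xs) with P? x
  ... | true  because _ = cong (_+_ 1ℤ) (length-filter P? xs)
  ... | false because _ = trans (length-filter P? xs) (≡.sym (ℤ.+-identityˡ _))

  -- Enumeration of graphs

  infix 4 _≈_

  -- Pointwise equality of adjacencies. Propositional equality would also compare functions and the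
  -- proofs in the record, so `graphs` is complete only up to `_≈_`, and whatever is evaluated on it
  -- needs a `-cong` lemma.
  _≈_ : Graph n → Graph n → Set
  G ≈ K = ∀ u v → adj G u v ≡ adj K u v

  induced : Graph n → (Fin k → Fin n) → Graph k
  induced G φ = record
    { adj    = λ u v → adj G (φ u) (φ v)
    ; sym    = λ u v → sym G (φ u) (φ v)
    ; irrefl = λ u → irrefl G (φ u)
    }

  bipartite : Subset n → Graph n
  bipartite A = record
    { adj    = λ u v → lookup A u xor lookup A v
    ; sym    = λ u v → xor-comm (lookup A u) (lookup A v)
    ; irrefl = λ u → xor-same (lookup A u)
    }

  extend : Subset n → Graph n → Graph (suc n)
  extend {n} A G = record { adj = adj⁺ ; sym = sym⁺ ; irrefl = irrefl⁺ }
    where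
    adj⁺ : Fin (suc n) → Fin (suc n) → Bool
    adj⁺ zero    zero    = false
    adj⁺ zero    (suc v) = lookup A v
    adj⁺ (suc u) zero    = lookup A u
    adj⁺ (suc u) (suc v) = adj G u v

    sym⁺ : ∀ u v → adj⁺ u v ≡ adj⁺ v u
    sym⁺ zero    zero    = refl
    sym⁺ zero    (suc v) = refl
    sym⁺ (suc u) zero    = refl
    sym⁺ (suc u) (suc v) = sym G u v

    irrefl⁺ : ∀ u → adj⁺ u u ≡ false
    irrefl⁺ zero    = refl
    irrefl⁺ (suc u) = irrefl G u

  graphs : ∀ n → List (Graph n)
  graphs zero    = [ record { adj = λ () ; sym = λ () ; irrefl = λ () } ]
  graphs (suc n) = cartesianProductWith extend (subsets n) (graphs n)

  ∈-subsets : (A : Subset n) → A ∈ˡ subsets n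
  ∈-subsets = ∈-vectors λ where
    false → here refl
    true  → there (here refl)

  graphs-complete : (G : Graph n) → ∃ λ K → K ∈ˡ graphs n × G ≈ K
  graphs-complete {zero}  G = _ , here refl , λ ()
  graphs-complete {suc n} G with graphs-complete (induced G suc)
  ... | K , K∈ , G≈K = extend N K , ∈-cartesianProductWith⁺ extend (∈-subsets N) K∈ , eq
    where
    N : Subset n
    N = tabulate (adj G zero ∘ suc)

    eq : G ≈ extend N K
    eq zero    zero    = irrefl G zero
    eq zero    (suc v) = ≡.sym (lookup∘tabulate _ v)
    eq (suc u) zero    = trans (sym G (suc u) zero) (≡.sym (lookup∘tabulate _ u))
    eq (suc u) (suc v) = G≈K u v

  -- Symmetrisation of weights on 5-tuples

  Weight₅ : Set → Set
  Weight₅ V = V → V → V → V → V → ℤ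

  infix 4 _≗₅_

  _≗₅_ : Weight₅ V → Weight₅ V → Set
  f ≗₅ g = ∀ a b c d e → f a b c d e ≡ g a b c d e

  ∑₅ : List V → Weight₅ V → ℤ
  ∑₅ xs f = ∑ xs λ a → ∑ xs λ b → ∑ xs λ c → ∑ xs λ d → ∑ xs λ e → f a b c d e

  infixl 6 _⊕_

  _⊕_ : Weight₅ V → Weight₅ V → Weight₅ V
  (f ⊕ g) a b c d e = f a b c d e + g a b c d e

  swap₀₁ swap₁₂ swap₂₃ swap₃₄ : Weight₅ V → Weight₅ V
  swap₀₁ f a b c d e = f b a c d e
  swap₁₂ f a b c d e = f a c b d e
  swap₂₃ f a b c d e = f a b d c e
  swap₃₄ f a b c d e = f a b c e d

  -- Sums over coset representatives of the symmetric group on j letters in the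
  -- one on suc j letters; their product runs through all 120 permutations.
  coset₁ coset₂ coset₃ coset₄ symmetrise : Weight₅ V → Weight₅ V
  coset₁ f = f ⊕ swap₀₁ f
  coset₂ f = f ⊕ swap₁₂ (coset₁ f)
  coset₃ f = f ⊕ swap₂₃ (coset₂ f)
  coset₄ f = f ⊕ swap₃₄ (coset₃ f)
  symmetrise f = coset₁ (coset₂ (coset₃ (coset₄ f)))

  symmetrise-cong : {f g : Weight₅ V} → f ≗₅ g → symmetrise f ≗₅ symmetrise g
  symmetrise-cong f≗g = coset₁-cong (coset₂-cong (coset₃-cong (coset₄-cong f≗g)))
    where
    coset₁-cong : {f g : Weight₅ V} → f ≗₅ g → coset₁ f ≗₅ coset₁ g
    coset₁-cong eq a b c d e = cong₂ _+_ (eq a b c d e) (eq b a c d e)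
    coset₂-cong : {f g : Weight₅ V} → f ≗₅ g → coset₂ f ≗₅ coset₂ g
    coset₂-cong eq a b c d e = cong₂ _+_ (eq a b c d e) (coset₁-cong eq a c b d e)
    coset₃-cong : {f g : Weight₅ V} → f ≗₅ g → coset₃ f ≗₅ coset₃ g
    coset₃-cong eq a b c d e = cong₂ _+_ (eq a b c d e) (coset₂-cong eq a b d c e)
    coset₄-cong : {f g : Weight₅ V} → f ≗₅ g → coset₄ f ≗₅ coset₄ g
    coset₄-cong eq a b c d e = cong₂ _+_ (eq a b c d e) (coset₃-cong eq a b c e d)

  ∑₅-cong : (xs : List V) {f g : Weight₅ V} → f ≗₅ g → ∑₅ xs f ≡ ∑₅ xs g
  ∑₅-cong xs eq = ∑-cong xs λ a → ∑-cong xs λ b → ∑-cong xs λ c → ∑-cong xs λ d →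
    ∑-cong xs λ e → eq a b c d e

  ∑₅-⊕ : (xs : List V) (f g : Weight₅ V) → ∑₅ xs (f ⊕ g) ≡ ∑₅ xs f + ∑₅ xs g
  ∑₅-⊕ xs f g =
    trans (∑-cong xs λ a → trans (∑-cong xs λ b → trans (∑-cong xs λ c →
      trans (∑-cong xs λ d → ∑-+ xs _ _) (∑-+ xs _ _)) (∑-+ xs _ _)) (∑-+ xs _ _))
    (∑-+ xs _ _)

  ∑₅-*ˡ : (xs : List V) (k : ℤ) (f : Weight₅ V) →
          ∑₅ xs (λ a b c d e → k * f a b c d e) ≡ k * ∑₅ xs f
  ∑₅-*ˡ xs k f =
    trans (∑-cong xs λ a → trans (∑-cong xs λ b → trans (∑-cong xs λ c →
      trans (∑-cong xs λ d → ∑-*ˡ xs k _) (∑-*ˡ xs k _)) (∑-*ˡ xs k _)) (∑-*ˡ xs k _))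
    (∑-*ˡ xs k _)

  -- The terms that a `coset` operator adds differ from `f` by exchanges of neighbouring summation
  -- variables, which preserve the total by `∑-swap`. The four operators multiply it by 2, 3, 4 and
  -- 5.
  ∑₅-symmetrise : (xs : List V) (f : Weight₅ V) → ∑₅ xs (symmetrise f) ≡ + 120 * ∑₅ xs f
  ∑₅-symmetrise xs f = begin
    ∑₅ xs (symmetrise f)
      ≡⟨ ∑-coset₁ _ ⟩
    + 2 * ∑₅ xs (coset₂ (coset₃ (coset₄ f)))
      ≡⟨ cong (+ 2 *_) (∑-coset₂ _) ⟩
    + 2 * (+ 3 * ∑₅ xs (coset₃ (coset₄ f)))
      ≡⟨ ℤ.*-assoc (+ 2) (+ 3) _ ⟨
    + 6 * ∑₅ xs (coset₃ (coset₄ f))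
      ≡⟨ cong (+ 6 *_) (∑-coset₃ _) ⟩
    + 6 * (+ 4 * ∑₅ xs (coset₄ f))
      ≡⟨ ℤ.*-assoc (+ 6) (+ 4) _ ⟨
    + 24 * ∑₅ xs (coset₄ f)
      ≡⟨ cong (+ 24 *_) (∑-coset₄ _) ⟩
    + 24 * (+ 5 * ∑₅ xs f)
      ≡⟨ ℤ.*-assoc (+ 24) (+ 5) _ ⟨
    + 120 * ∑₅ xs f
      ∎
    where
    open ≡-Reasoning

    step : (f g : Weight₅ _) (k : ℕ) {s : Weight₅ _ → Weight₅ _} →
           ∑₅ xs (s g) ≡ ∑₅ xs g → ∑₅ xs g ≡ + k * ∑₅ xs f →
           ∑₅ xs (f ⊕ s g) ≡ + suc k * ∑₅ xs f
    step f g k inv eq = trans (∑₅-⊕ xs f _)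
      (trans (cong (_+_ (∑₅ xs f)) (trans inv eq)) (≡.sym (ℤ.suc-* (+ k) _)))

    ∑-coset₁ : ∀ f → ∑₅ xs (coset₁ f) ≡ + 2 * ∑₅ xs f
    ∑-coset₁ f = step f f 1 {swap₀₁} (∑-swap xs xs _) (≡.sym (ℤ.*-identityˡ _))

    ∑-coset₂ : ∀ f → ∑₅ xs (coset₂ f) ≡ + 3 * ∑₅ xs f
    ∑-coset₂ f = step f (coset₁ f) 2 {swap₁₂}
      (∑-cong xs λ a → ∑-swap xs xs _) (∑-coset₁ f)

    ∑-coset₃ : ∀ f → ∑₅ xs (coset₃ f) ≡ + 4 * ∑₅ xs f
    ∑-coset₃ f = step f (coset₂ f) 3 {swap₂₃}
      (∑-cong xs λ a → ∑-cong xs λ b → ∑-swap xs xs _) (∑-coset₂ f)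

    ∑-coset₄ : ∀ f → ∑₅ xs (coset₄ f) ≡ + 5 * ∑₅ xs f
    ∑-coset₄ f = step f (coset₃ f) 4 {swap₃₄}
      (∑-cong xs λ a → ∑-cong xs λ b → ∑-cong xs λ c → ∑-swap xs xs _) (∑-coset₃ f)

  -- The values make the sums of rooted over (b, c) and of difference over d vanish in
  -- a balanced complete bipartite graph, also when one vertex is made isolated.  The
  -- coefficients 5 and 2 come from a linear program over the graphs of order 5.
  module Certificate (_~_ : V → V → Bool) where

    copy : V → V → V → V → ℤ
    copy a b c d = ⟦ a ~ c ∧ not (a ~ b) ∧ not (a ~ d) ∧ not (b ~ d) ⟧

    rooted : V → V → V → ℤ
    rooted a b c = weight (a ~ b) (a ~ c) (b ~ c)
      where
      weight : Bool → Bool → Bool → ℤ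
      weight false false false = + 4
      weight true  true  false = + 4
      weight true  true  true  = - + 3
      weight true  false false = - + 1
      weight false true  false = - + 1
      weight _     _     true  = - + 4

    pairWeight : V → V → V → ℤ
    pairWeight a b c =
      if a ~ c then 0ℤ else if b ~ c then 0ℤ else if a ~ b then + 5 else + 2

    difference : V → V → V → V → ℤ
    difference a b c d = if c ~ d then 0ℤ else ⟦ a ~ d ⟧ - ⟦ b ~ d ⟧

    excess squares slack : Weight₅ V
    excess  a b c d e = 1ℤ - + 8 * copy a b c d
    squares a b c d e =
      rooted a b c * rooted a d e
      + + 16 * (pairWeight a b c * (difference a b c d * difference a b c e))
    slack   a b c d e = + 16 * excess a b c d e - squares a b c d e

  open Certificate

  slack-cong : {_~₁_ _~₂_ : V → V → Bool} → (∀ u v → u ~₁ v ≡ u ~₂ v) →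
               slack _~₁_ ≗₅ slack _~₂_
  slack-cong eq a b c d e
    rewrite eq a b | eq a c | eq a d | eq a e | eq b c | eq b d | eq b e
          | eq c d | eq c e | eq d e = refl

  -- Opaque, as its 120 summands must not be unfolded on graphs that are not explicit.
  opaque
    symmetricAt : Weight₅ V → V → V → V → V → V → ℤ
    symmetricAt = symmetrise

    symmetricAt-cong : {f g : Weight₅ V} → f ≗₅ g → symmetricAt f ≗₅ symmetricAt g
    symmetricAt-cong = symmetrise-cong

  -- Verification of the certificate on the graphs of order 5

  symmetricSlack : Graph 5 → ℤ
  symmetricSlack K = symmetricAt (slack (adj K)) 0F 1F 2F 3F 4F

  symmetricSlack-cong : {K L : Graph 5} → K ≈ L → symmetricSlack K ≡ symmetricSlack L
  symmetricSlack-cong K≈L = symmetricAt-cong (slack-cong K≈L) 0F 1F 2F 3F 4F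

  -- The isomorphism is restricted to the transposition of `zero` and the isolated vertex `v`,
  -- because any arrangement of the other vertices is absorbed by `A`. This leaves only a small
  -- search for `extremal?`.
  Isolated+Bipartite : Graph (suc n) → Set
  Isolated+Bipartite {n} F = ∃ λ v → Σ (Subset n) λ A → ∀ u w →
    adj F u w ≡ adj (addIsolated (bipartite A)) (transpose zero v ⟨$⟩ʳ u) (transpose zero v ⟨$⟩ʳ w)

  Extremal : Graph (suc n) → Set
  Extremal F = CompleteBipartite F ⊎ Isolated+Bipartite F

  extremal? : (F : Graph (suc n)) → Dec (Extremal F)
  extremal? F =
    (anySubset? λ A → all? λ u → all? λ w → adj F u w ≟ᵇ _)
    ⊎-dec
    (any? λ v → anySubset? λ A → all? λ u → all? λ w → adj F u w ≟ᵇ _)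

  extremal-cong : {F K : Graph (suc n)} → F ≈ K → Extremal K → Extremal F
  extremal-cong F≈K (inj₁ (A , eq))     = inj₁ (A , λ u w → trans (F≈K u w) (eq u w))
  extremal-cong F≈K (inj₂ (v , A , eq)) = inj₂ (v , A , λ u w → trans (F≈K u w) (eq u w))

  -- Non-negativity in both cases yields the bound 1/8. The gap of 1 outside the extremal graphs is
  -- what later makes the density of such a graph vanish.
  Classified : Graph 5 → Set
  Classified K = 1ℤ ≤ symmetricSlack K ⊎ (0ℤ ≤ symmetricSlack K × Extremal K)

  classified-cong : {K L : Graph 5} → K ≈ L → Classified L → Classified K
  classified-cong {K} {L} K≈L = Sum.map (subst (1ℤ ≤_) eq)
    (Product.map (subst (0ℤ ≤_) eq) (extremal-cong {F = K} {L} K≈L))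
    where
    eq : symmetricSlack L ≡ symmetricSlack K
    eq = ≡.sym (symmetricSlack-cong {K} {L} K≈L)

  opaque
    unfolding symmetricAt

    -- The finite computation of the proof: with `symmetricAt` unfolded, the weight is evaluated on
    -- all 1024 labelled graphs of order 5.
    classified-graphs : All Classified (graphs 5)
    classified-graphs = from-yes (All.all? (λ K →
      (1ℤ ≤? symmetricSlack K) ⊎-dec ((0ℤ ≤? symmetricSlack K) ×-dec extremal? K)) (graphs 5))

  classified : (K : Graph 5) → Classified K
  classified K =
    let L , L∈ , K≈L = graphs-complete K
    in classified-cong {K} {L} K≈L (All.lookup classified-graphs L∈)

  -- Summation of the certificate over all 5-tuples of vertices

  0≤i*i : ∀ i → 0ℤ ≤ i * i
  0≤i*i (+ zero)  = +≤+ z≤n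
  0≤i*i (+ suc _) = +≤+ z≤n
  0≤i*i -[1+ _ ]  = +≤+ z≤n

  0≤* : ∀ {i j} → 0ℤ ≤ i → 0ℤ ≤ j → 0ℤ ≤ i * j
  0≤* {+ m} {+ n} _ _ = subst (0ℤ ≤_) (ℤ.pos-* m n) (+≤+ z≤n)

  -- The pairs (`b`, `c`) and (`d`, `e`) vary independently, so the fourfold sum factors.
  ∑-square₂ : (xs : List V) (f : V → V → ℤ) →
              ∑ xs (λ b → ∑ xs λ c → ∑ xs λ d → ∑ xs λ e → f b c * f d e)
              ≡ ∑ xs (λ b → ∑ xs (f b)) * ∑ xs (λ b → ∑ xs (f b))
  ∑-square₂ xs f = trans
    (∑-cong xs λ b → trans
      (∑-cong xs λ c → trans (∑-cong xs λ d → ∑-*ˡ xs (f b c) (f d)) (∑-*ˡ xs (f b c) _))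
      (∑-*ʳ xs (f b) _))
    (∑-*ʳ xs _ _)

  module _ (_~_ : V → V → Bool) (xs : List V) where

    0≤pairWeight : ∀ a b c → 0ℤ ≤ pairWeight _~_ a b c
    0≤pairWeight a b c with a ~ c | b ~ c | a ~ b
    ... | true  | _     | _     = +≤+ z≤n
    ... | false | true  | _     = +≤+ z≤n
    ... | false | false | true  = +≤+ z≤n
    ... | false | false | false = +≤+ z≤n

    -- For fixed `a`, the first summand adds up to the square of the sum of `rooted` over pairs. For
    -- fixed `a`, `b`, `c`, the second adds up over `d` and `e` to a non-negative weight times the
    -- square of the sum of `difference`.
    0≤∑₅-squares : 0ℤ ≤ ∑₅ xs (squares _~_)
    0≤∑₅-squares = subst (0ℤ ≤_)
      (≡.sym (∑₅-⊕ xs (λ a b c d e → rooted _~_ a b c * rooted _~_ a d e) _))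
      (ℤ.+-mono-≤
        (∑-nonneg xs λ a → subst (0ℤ ≤_) (≡.sym (∑-square₂ xs (rooted _~_ a)))
          (0≤i*i (∑ xs λ b → ∑ xs (rooted _~_ a b))))
        (subst (0ℤ ≤_) (≡.sym (∑₅-*ˡ xs (+ 16) _)) (0≤* {+ 16} (+≤+ z≤n)
          (∑-nonneg xs λ a → ∑-nonneg xs λ b → ∑-nonneg xs λ c →
            subst (0ℤ ≤_) (≡.sym (weighted a b c)) (0≤* (0≤pairWeight a b c)
              (0≤i*i (∑ xs (difference _~_ a b c))))))))
      where
      weighted : ∀ a b c → let w = pairWeight _~_ a b c ; D = difference _~_ a b c in
                 ∑ xs (λ d → ∑ xs λ e → w * (D d * D e)) ≡ w * (∑ xs D * ∑ xs D)
      weighted a b c =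
        let w = pairWeight _~_ a b c ; D = difference _~_ a b c in
        trans (∑-cong xs λ d → ∑-*ˡ xs w λ e → D d * D e)
          (trans (∑-*ˡ xs w λ d → ∑ xs λ e → D d * D e) (cong (_*_ w) (∑-* xs xs D D)))

    ∑₅-slack≤ : ∑₅ xs (slack _~_) ≤ + 16 * ∑₅ xs (excess _~_)
    ∑₅-slack≤ = begin
      ∑₅ xs (slack _~_)
        ≡⟨ ℤ.+-identityʳ _ ⟨
      ∑₅ xs (slack _~_) + 0ℤ
        ≤⟨ ℤ.+-monoʳ-≤ (∑₅ xs (slack _~_)) 0≤∑₅-squares ⟩
      ∑₅ xs (slack _~_) + ∑₅ xs (squares _~_)
        ≡⟨ ∑₅-⊕ xs _ _ ⟨
      ∑₅ xs (slack _~_ ⊕ squares _~_)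
        ≡⟨ ∑₅-cong xs (λ a b c d e →
             cancel (+ 16 * excess _~_ a b c d e) (squares _~_ a b c d e)) ⟩
      ∑₅ xs (λ a b c d e → + 16 * excess _~_ a b c d e)
        ≡⟨ ∑₅-*ˡ xs (+ 16) _ ⟩
      + 16 * ∑₅ xs (excess _~_)
        ∎
      where
      open ℤ.≤-Reasoning
      cancel : ∀ x y → x - y + y ≡ x
      cancel = solve-∀

  ∑₄ : List V → (V → V → V → V → ℤ) → ℤ
  ∑₄ xs f = ∑ xs λ a → ∑ xs λ b → ∑ xs λ c → ∑ xs λ d → f a b c d

  ∑₄-cong : (xs : List V) {f g : V → V → V → V → ℤ} →
            (∀ a b c d → f a b c d ≡ g a b c d) → ∑₄ xs f ≡ ∑₄ xs g
  ∑₄-cong xs eq = ∑-cong xs λ a → ∑-cong xs λ b → ∑-cong xs λ c → ∑-cong xs λ d → eq a b c d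

  ∑₄-mono : (xs : List V) {f g : V → V → V → V → ℤ} →
            (∀ a b c d → f a b c d ≤ g a b c d) → ∑₄ xs f ≤ ∑₄ xs g
  ∑₄-mono xs f≤g = ∑-mono xs λ a → ∑-mono xs λ b → ∑-mono xs λ c → ∑-mono xs λ d → f≤g a b c d

  ∑₄-+ : (xs : List V) (f g : V → V → V → V → ℤ) →
         ∑₄ xs (λ a b c d → f a b c d + g a b c d) ≡ ∑₄ xs f + ∑₄ xs g
  ∑₄-+ xs f g =
    trans (∑-cong xs λ a → trans (∑-cong xs λ b → trans (∑-cong xs λ c →
      ∑-+ xs _ _) (∑-+ xs _ _)) (∑-+ xs _ _)) (∑-+ xs _ _)

  ∑₄-*ˡ : (xs : List V) (k : ℤ) (f : V → V → V → V → ℤ) →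
          ∑₄ xs (λ a b c d → k * f a b c d) ≡ k * ∑₄ xs f
  ∑₄-*ˡ xs k f =
    trans (∑-cong xs λ a → trans (∑-cong xs λ b → trans (∑-cong xs λ c →
      ∑-*ˡ xs k _) (∑-*ˡ xs k _)) (∑-*ˡ xs k _)) (∑-*ˡ xs k _)

  ∑-allFin-const : ∀ n (c : ℤ) → ∑ (allFin n) (λ _ → c) ≡ + n * c
  ∑-allFin-const n c = trans (∑-const (allFin n) c)
    (cong (λ m → + m * c) (length-tabulate {n = n} id))

  infix 9 _⁴
  _⁴ : ℤ → ℤ
  i ⁴ = i * (i * (i * i))

  -- The fifth vertex does not occur in `excess`, whence the outer factor n; the constant 1 summed
  -- over the remaining 4-tuples gives n⁴.
  ∑₅-excess : (_~_ : Fin n → Fin n → Bool) →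
    ∑₅ (allFin n) (excess _~_) ≡ + n * ((+ n) ⁴ - + 8 * ∑₄ (allFin n) (copy _~_))
  ∑₅-excess {n} _~_ = begin
    ∑₅ vs (excess _~_)
      ≡⟨ ∑₄-cong vs (λ a b c d → ∑-allFin-const n (δ a b c d)) ⟩
    ∑₄ vs (λ a b c d → + n * δ a b c d)
      ≡⟨ ∑₄-*ˡ vs (+ n) δ ⟩
    + n * ∑₄ vs δ
      ≡⟨ cong (_*_ (+ n)) (move (∑₄ vs δ) (+ 8 * ∑₄ vs (copy _~_))) ⟩
    + n * (∑₄ vs δ + + 8 * ∑₄ vs (copy _~_) - + 8 * ∑₄ vs (copy _~_))
      ≡⟨ cong (λ s → + n * (s - + 8 * ∑₄ vs (copy _~_))) total ⟩
    + n * ((+ n) ⁴ - + 8 * ∑₄ vs (copy _~_))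
      ∎
    where
    open ≡-Reasoning
    vs = allFin n
    δ : Fin n → Fin n → Fin n → Fin n → ℤ
    δ a b c d = 1ℤ - + 8 * copy _~_ a b c d

    move : ∀ x y → x ≡ x + y - y
    move = solve-∀

    cancel : ∀ x → 1ℤ - x + x ≡ 1ℤ
    cancel = solve-∀

    total : ∑₄ vs δ + + 8 * ∑₄ vs (copy _~_) ≡ (+ n) ⁴
    total = begin
      ∑₄ vs δ + + 8 * ∑₄ vs (copy _~_)
        ≡⟨ cong (_+_ (∑₄ vs δ)) (∑₄-*ˡ vs (+ 8) _) ⟨
      ∑₄ vs δ + ∑₄ vs (λ a b c d → + 8 * copy _~_ a b c d)
        ≡⟨ ∑₄-+ vs _ _ ⟨
      ∑₄ vs (λ a b c d → δ a b c d + + 8 * copy _~_ a b c d)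
        ≡⟨ ∑₄-cong vs (λ a b c d → cancel (+ 8 * copy _~_ a b c d)) ⟩
      ∑₄ vs (λ a b c d → 1ℤ)
        ≡⟨ (∑-cong vs λ a → trans (∑-cong vs λ b → trans (∑-cong vs λ c →
             ∑-allFin-const n _) (∑-allFin-const n _)) (∑-allFin-const n _)) ⟩
      ∑ vs (λ a → + n * (+ n * (+ n * 1ℤ)))
        ≡⟨ ∑-allFin-const n _ ⟩
      + n * (+ n * (+ n * (+ n * 1ℤ)))
        ≡⟨ cong (λ m → + n * (+ n * (+ n * m))) (ℤ.*-identityʳ (+ n)) ⟩
      (+ n) ⁴
        ∎

  opaque
    unfolding symmetricAt

    ∑₅-symmetricAt : (xs : List V) (f : Weight₅ V) → ∑₅ xs (symmetricAt f) ≡ + 120 * ∑₅ xs f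
    ∑₅-symmetricAt = ∑₅-symmetrise

    -- Symmetrising only permutes arguments and so commutes with the substitution of `h`. This holds
    -- by `refl` only where `symmetricAt` unfolds.
    symmetricAt-map : (h : W → V) (f : Weight₅ V) → ∀ a b c d e →
      symmetricAt f (h a) (h b) (h c) (h d) (h e)
      ≡ symmetricAt (λ a b c d e → f (h a) (h b) (h c) (h d) (h e)) a b c d e
    symmetricAt-map h f a b c d e = refl

  symmetricSlack-induced : (G : Graph n) (φ : Vec (Fin n) 5) →
    symmetricSlack (induced G (lookup φ))
    ≡ symmetricAt (slack (adj G))
        (lookup φ 0F) (lookup φ 1F) (lookup φ 2F) (lookup φ 3F) (lookup φ 4F)
  symmetricSlack-induced G φ = trans
    (symmetricAt-cong (λ a b c d e → refl) 0F 1F 2F 3F 4F)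
    (≡.sym (symmetricAt-map (lookup φ) (slack (adj G)) 0F 1F 2F 3F 4F))

  ∑-tuples : ∀ n k (f : Vec (Fin n) (suc k) → ℤ) →
             ∑ (tuples n (suc k)) f ≡ ∑ (allFin n) λ v → ∑ (tuples n k) λ φ → f (v ∷ φ)
  ∑-tuples n k = ∑-cartesianProductWith _∷_ (allFin n) (tuples n k)

  ∑-tuples₄ : ∀ n (f : Vec (Fin n) 4 → ℤ) →
              ∑ (tuples n 4) f ≡ ∑₄ (allFin n) λ a b c d → f (a ∷ b ∷ c ∷ d ∷ [])
  ∑-tuples₄ n f =
    trans (∑-tuples n 3 f) (∑-cong vs λ a →
    trans (∑-tuples n 2 _) (∑-cong vs λ b →
    trans (∑-tuples n 1 _) (∑-cong vs λ c →
    trans (∑-tuples n 0 _) (∑-cong vs λ d → ℤ.+-identityʳ _))))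
    where vs = allFin n

  ∑-tuples₅ : ∀ n (f : Vec (Fin n) 5 → ℤ) →
              ∑ (tuples n 5) f ≡ ∑₅ (allFin n) λ a b c d e → f (a ∷ b ∷ c ∷ d ∷ e ∷ [])
  ∑-tuples₅ n f = trans (∑-tuples n 4 f) (∑-cong (allFin n) λ a → ∑-tuples₄ n λ φ → f (a ∷ φ))

  _≈?_ : (G K : Graph n) → Dec (G ≈ K)
  G ≈? K = all? λ u → all? λ v → adj G u v ≟ᵇ adj K u v

  0≤symmetricSlack : (K : Graph 5) → 0ℤ ≤ symmetricSlack K
  0≤symmetricSlack K = Sum.[ ℤ.≤-trans (+≤+ z≤n) , proj₁ ]′ (classified K)

  symmetricSlack≤excess : (G : Graph n) →
    ∑ (tuples n 5) (λ φ → symmetricSlack (induced G (lookup φ)))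
    ≤ + 1920 * (+ n * ((+ n) ⁴ - + 8 * ∑₄ (allFin n) (copy (adj G))))
  symmetricSlack≤excess {n} G = begin
    ∑ (tuples n 5) (λ φ → symmetricSlack (induced G (lookup φ)))
      ≡⟨ ∑-tuples₅ n _ ⟩
    ∑₅ vs (λ a b c d e → symmetricSlack (induced G (lookup (a ∷ b ∷ c ∷ d ∷ e ∷ []))))
      ≡⟨ ∑₅-cong vs (λ a b c d e → symmetricSlack-induced G (a ∷ b ∷ c ∷ d ∷ e ∷ [])) ⟩
    ∑₅ vs (symmetricAt (slack (adj G)))
      ≡⟨ ∑₅-symmetricAt vs _ ⟩
    + 120 * ∑₅ vs (slack (adj G))
      ≤⟨ ℤ.*-monoˡ-≤-nonNeg (+ 120) (∑₅-slack≤ (adj G) vs) ⟩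
    + 120 * (+ 16 * ∑₅ vs (excess (adj G)))
      ≡⟨ ℤ.*-assoc (+ 120) (+ 16) _ ⟨
    + 1920 * ∑₅ vs (excess (adj G))
      ≡⟨ cong (_*_ (+ 1920)) (∑₅-excess (adj G)) ⟩
    + 1920 * (+ n * ((+ n) ⁴ - + 8 * ∑₄ vs (copy (adj G))))
      ∎
    where
    open ℤ.≤-Reasoning
    vs = allFin n

  0≤excess : (G : Graph n) →
    0ℤ ≤ + 1920 * (+ n * ((+ n) ⁴ - + 8 * ∑₄ (allFin n) (copy (adj G))))
  0≤excess {n} G = ℤ.≤-trans
    (∑-nonneg (tuples n 5) λ φ → 0≤symmetricSlack (induced G (lookup φ)))
    (symmetricSlack≤excess G)

  -- A tuple along which `G` pulls back to `F` contributes the weight of `F`, which is at least 1,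
  -- and every other tuple contributes a non-negative amount.
  copies≤excess : (F : Graph 5) → 1ℤ ≤ symmetricSlack F → (G : Graph n) →
    ∑ (tuples n 5) (λ φ → ⟦ does (F ≈? induced G (lookup φ)) ⟧)
    ≤ + 1920 * (+ n * ((+ n) ⁴ - + 8 * ∑₄ (allFin n) (copy (adj G))))
  copies≤excess {n} F 1≤s G = ℤ.≤-trans
    (∑-mono (tuples n 5) λ φ → ⟦does⟧≤ (F ≈? induced G (lookup φ))
      (0≤symmetricSlack (induced G (lookup φ)))
      λ F≈ → subst (1ℤ ≤_) (symmetricSlack-cong {F} {induced G (lookup φ)} F≈) 1≤s)
    (symmetricSlack≤excess G)

  ∑-tabulate : (h : Fin n → V) (f : V → ℤ) → ∑ (List.tabulate h) f ≡ ∑ (allFin n) (f ∘ h)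
  ∑-tabulate {n = n} h f = trans (cong (λ xs → ∑ xs f) (≡.sym (map-tabulate id h)))
    (∑-map h (allFin n) f)

  -- Copies and embeddings

  Λ≡∑₄ : ∀ {n} (G : Graph n) →
         + Λ H G ≡ ∑₄ (allFin n) λ a b c d → ⟦ does (isEmbedding? H G (a ∷ b ∷ c ∷ d ∷ [])) ⟧
  Λ≡∑₄ {n} G = trans (length-filter (isEmbedding? H G) (tuples n 4)) (∑-tuples₄ n _)

  0≤copy : (_~_ : V → V → Bool) → ∀ a b c d → 0ℤ ≤ copy _~_ a b c d
  0≤copy _~_ a b c d = 0≤⟦ _ ⟧

  copy≡1 : (_~_ : V → V → Bool) → ∀ {a b c d} →
           a ~ c ≡ true → a ~ b ≡ false → a ~ d ≡ false → b ~ d ≡ false → copy _~_ a b c d ≡ 1ℤ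
  copy≡1 _~_ ac ab ad bd rewrite ac | ab | ad | bd = refl

  Λ≤∑₄-copy : (G : Graph n) → + Λ H G ≤ ∑₄ (allFin n) (copy (adj G))
  Λ≤∑₄-copy {n} G = subst (_≤ ∑₄ (allFin n) (copy (adj G))) (≡.sym (Λ≡∑₄ G))
    (∑₄-mono (allFin n) λ a b c d →
      ⟦does⟧≤ (isEmbedding? H G (a ∷ b ∷ c ∷ d ∷ [])) (0≤copy (adj G) a b c d)
        λ (_ , red⇒ , blue⇒) → ℤ.≤-reflexive (≡.sym (copy≡1 (adj G)
          (red⇒ 0F 2F refl) (blue⇒ 0F 1F refl) (blue⇒ 0F 3F refl) (blue⇒ 1F 3F refl))))

  copy≤ : (_~_ : V → V → Bool) → ∀ {a b c d x} → 0ℤ ≤ x →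
          (a ~ c ≡ true → a ~ b ≡ false → a ~ d ≡ false → b ~ d ≡ false → 1ℤ ≤ x) →
          copy _~_ a b c d ≤ x
  copy≤ _~_ {a} {b} {c} {d} 0≤x 1≤x with a ~ c | a ~ b | a ~ d | b ~ d
  ... | false | _     | _     | _     = 0≤x
  ... | true  | true  | _     | _     = 0≤x
  ... | true  | false | true  | _     = 0≤x
  ... | true  | false | false | true  = 0≤x
  ... | true  | false | false | false = 1≤x refl refl refl refl

  red-edges : ∀ i j → adj (red H) i j ≡ true → (i ≡ 0F × j ≡ 2F) ⊎ (i ≡ 2F × j ≡ 0F)
  red-edges = from-yes (all? λ i → all? λ j → (adj (red H) i j ≟ᵇ true) →-dec
    (((i ≟ 0F) ×-dec (j ≟ 2F)) ⊎-dec ((i ≟ 2F) ×-dec (j ≟ 0F))))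

  blue-edges : ∀ i j → adj (blue H) i j ≡ true → i ≢ 2F × j ≢ 2F
  blue-edges = from-yes (all? λ i → all? λ j → (adj (blue H) i j ≟ᵇ true) →-dec
    (¬? (i ≟ 2F) ×-dec ¬? (j ≟ 2F)))

  module _ (G : Graph n) {a b c d : Fin n}
           (ac : adj G a c ≡ true) (ab : adj G a b ≡ false)
           (ad : adj G a d ≡ false) (bd : adj G b d ≡ false)
           where

    private
      ≢ʳ : ∀ {u} → adj G a u ≡ false → u ≢ c
      -- Being adjacent to `a`, the vertex `c` differs from every non-neighbour of `a`, among them
      -- `a` itself.
      ≢ʳ au refl = contradiction (trans (≡.sym ac) au) λ ()

    isEmbedding : a ≢ b → a ≢ d → b ≢ d → IsEmbedding H G (a ∷ b ∷ c ∷ d ∷ [])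
    isEmbedding a≢b a≢d b≢d = lookup-injective unique _ _ , reds , blues
      where
      φ = a ∷ b ∷ c ∷ d ∷ []

      unique : Unique φ
      unique = (a≢b ∷ ≢ʳ (irrefl G a) ∷ a≢d ∷ []) ∷ (≢ʳ ab ∷ b≢d ∷ [])
             ∷ (≢-sym (≢ʳ ad) ∷ []) ∷ [] ∷ []

      reds : ∀ i j → adj (red H) i j ≡ true → adj G (lookup φ i) (lookup φ j) ≡ true
      reds i j e with red-edges i j e
      ... | inj₁ (refl , refl) = ac
      ... | inj₂ (refl , refl) = trans (sym G c a) ac

      blues : ∀ i j → adj (blue H) i j ≡ true → adj G (lookup φ i) (lookup φ j) ≡ false
      blues 2F j  e = contradiction refl (proj₁ (blue-edges 2F j e))
      blues i  2F e = contradiction refl (proj₂ (blue-edges i 2F e))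
      blues 0F 0F _ = irrefl G a
      blues 0F 1F _ = ab
      blues 0F 3F _ = ad
      blues 1F 0F _ = trans (sym G b a) ab
      blues 1F 1F _ = irrefl G b
      blues 1F 3F _ = bd
      blues 3F 0F _ = trans (sym G d a) ad
      blues 3F 1F _ = trans (sym G d b) bd
      blues 3F 3F _ = irrefl G d

  same : Fin n → Fin n → ℤ
  same u v = ⟦ does (u ≟ v) ⟧

  -- A copy which is not injective identifies two of the three pairwise
  -- non-adjacent vertices: c is told apart from them by its adjacency to a.
  copy≤embedding : (G : Graph n) → ∀ a b c d →
    copy (adj G) a b c d
    ≤ ⟦ does (isEmbedding? H G (a ∷ b ∷ c ∷ d ∷ [])) ⟧ + (same a b + (same a d + same b d))
  copy≤embedding G a b c d = copy≤ (adj G)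
    (ℤ.+-mono-≤ (0≤⟦ does emb? ⟧) (ℤ.+-mono-≤ (0≤⟦ does (a ≟ b) ⟧)
      (ℤ.+-mono-≤ (0≤⟦ does (a ≟ d) ⟧) (0≤⟦ does (b ≟ d) ⟧))))
    (λ ac ab ad bd → split (does emb?) (a ≟ b) (a ≟ d) (b ≟ d)
      λ a≢b a≢d b≢d → dec-true emb? (isEmbedding G ac ab ad bd a≢b a≢d b≢d))
    where
    emb? = isEmbedding? H G (a ∷ b ∷ c ∷ d ∷ [])

    split : ∀ e (p : Dec (a ≡ b)) (q : Dec (a ≡ d)) (r : Dec (b ≡ d)) →
            (a ≢ b → a ≢ d → b ≢ d → e ≡ true) →
            1ℤ ≤ ⟦ e ⟧ + (⟦ does p ⟧ + (⟦ does q ⟧ + ⟦ does r ⟧))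
    split e (yes _) q       r       f = ℤ.+-mono-≤ 0≤⟦ e ⟧
      (ℤ.+-mono-≤ (ℤ.≤-refl {1ℤ}) (ℤ.+-mono-≤ 0≤⟦ does q ⟧ 0≤⟦ does r ⟧))
    split e (no _)  (yes _) r       f = ℤ.+-mono-≤ 0≤⟦ e ⟧
      (ℤ.+-mono-≤ (ℤ.≤-refl {0ℤ}) (ℤ.+-mono-≤ (ℤ.≤-refl {1ℤ}) 0≤⟦ does r ⟧))
    split e (no _)  (no _)  (yes _) f = ℤ.+-mono-≤ 0≤⟦ e ⟧ (ℤ.≤-refl {1ℤ})
    split e (no p)  (no q)  (no r)  f rewrite f p q r = ℤ.≤-refl

  ∑-≟ : (u : Fin n) → ∑ (allFin n) (λ v → same u v) ≡ 1ℤ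
  ∑-≟ {suc n} zero    = cong (_+_ 1ℤ) (trans (∑-tabulate {n} Fin.suc (same {suc n} zero))
    (trans (∑-allFin-const n 0ℤ) (ℤ.*-zeroʳ (+ n))))
  ∑-≟ {suc n} (suc u) = trans (ℤ.+-identityˡ _)
    (trans (∑-tabulate Fin.suc (same (suc u))) (∑-≟ u))

  -- Each of the three possible coincidences determines one entry by another and leaves n³ tuples.
  ∑₄-copy≤Λ : (G : Graph n) →
              ∑₄ (allFin n) (copy (adj G)) ≤ + Λ H G + + 3 * (+ n * (+ n * + n))
  ∑₄-copy≤Λ {n} G = begin
    ∑₄ vs (copy (adj G))
      ≤⟨ ∑₄-mono vs (copy≤embedding G) ⟩
    ∑₄ vs (λ a b c d → emb a b c d + (same a b + (same a d + same b d)))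
      ≡⟨ trans (∑₄-+ vs emb _) (cong (_+_ (∑₄ vs emb))
           (trans (∑₄-+ vs (λ a b _ _ → same a b) _)
             (cong (_+_ (∑₄ vs λ a b _ _ → same a b))
               (∑₄-+ vs (λ a _ _ d → same a d) (λ _ b _ d → same b d))))) ⟩
    ∑₄ vs emb + (∑₄ vs (λ a b _ _ → same a b)
      + (∑₄ vs (λ a _ _ d → same a d) + ∑₄ vs (λ _ b _ d → same b d)))
      ≡⟨ cong₂ _+_ (≡.sym (Λ≡∑₄ G)) (cong₂ _+_ ab (cong₂ _+_ ad bd)) ⟩
    + Λ H G + (N³ + (N³ + N³))
      ≡⟨ cong (_+_ (+ Λ H G)) (triple N³) ⟩
    + Λ H G + + 3 * N³
      ∎
    where
    open ℤ.≤-Reasoning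
    vs = allFin n
    N³ = + n * (+ n * + n)

    emb : Fin n → Fin n → Fin n → Fin n → ℤ
    emb a b c d = ⟦ does (isEmbedding? H G (a ∷ b ∷ c ∷ d ∷ [])) ⟧

    triple : ∀ x → x + (x + x) ≡ + 3 * x
    triple = solve-∀

    const : ∀ c → ∑ vs (λ _ → c) ≡ + n * c
    const = ∑-allFin-const n

    one : ∑ vs (λ _ → 1ℤ) ≡ + n
    one = trans (const 1ℤ) (ℤ.*-identityʳ (+ n))

    bd : ∑₄ vs (λ _ b _ d → same b d) ≡ N³
    bd = trans (const _) (cong (_*_ (+ n)) (trans
      (∑-cong vs λ b → trans (∑-cong vs λ _ → ∑-≟ b) one) (const _)))

    ad : ∑₄ vs (λ a _ _ d → same a d) ≡ N³
    ad = trans (∑-cong vs λ a → trans (∑-cong vs λ _ →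
      trans (∑-cong vs λ _ → ∑-≟ a) one) (const _)) (const _)

    ab : ∑₄ vs (λ a b _ _ → same a b) ≡ N³
    ab = trans (∑-cong vs λ a → trans
      (trans (∑-cong vs λ b → trans (const _)
               (cong (_*_ (+ n)) (trans (const _) (ℤ.*-comm (+ n) _))))
        (trans (∑-*ˡ vs (+ n) (λ b → same a b * + n))
          (cong (_*_ (+ n)) (∑-*ʳ vs (same a) (+ n)))))
      (cong (λ s → + n * (s * + n)) (∑-≟ a)))
      (trans (const _) (cong (λ m → + n * (+ n * m)) (ℤ.*-identityˡ (+ n))))

  -- Induced subgraphs

  isCopy? : (F : Graph k) (G : Graph n) (S : Subset n) (φ : Vec (Fin n) k) →
            Dec (IsInducedCopy F G S φ)
  isCopy? F G S φ = inj? φ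
    ×-dec (all? λ i → lookup φ i ∈? S)
    ×-dec (all? λ v → (v ∈? S) →-dec any? λ i → lookup φ i ≟ v)
    ×-dec (all? λ i → all? λ j → adj F i j ≟ᵇ _)

  image : Vec (Fin n) k → Subset n
  image φ = tabulate λ v → does (any? λ i → lookup φ i ≟ v)

  -- The tuple maps onto `S` and therefore determines it, so each tuple accounts for at most one
  -- set.
  copy⇒image : {F : Graph k} {G : Graph n} {S : Subset n} {φ : Vec (Fin n) k} →
               IsInducedCopy F G S φ → S ≡ image φ
  copy⇒image {S = S} {φ} (_ , ∈S , S⊆ , _) =
    trans (≡.sym (tabulate∘lookup S))
      (tabulate-cong λ v → same-side v (any? λ i → lookup φ i ≟ v))
    where
    same-side : ∀ v (v∈? : Dec (∃ λ i → lookup φ i ≡ v)) → lookup S v ≡ does v∈?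
    same-side v (yes (i , refl)) = []=⇒lookup (∈S i)
    same-side v (no v∉) with lookup S v in eq
    ... | true  = contradiction (S⊆ v (lookup⇒[]= v S eq)) v∉
    ... | false = refl

  subset-≟ : (S T : Subset n) → Dec (S ≡ T)
  subset-≟ = ≡-dec _≟ᵇ_

  ∑-subsets-≟ : (T : Subset n) → ∑ (subsets n) (λ S → ⟦ does (subset-≟ S T) ⟧) ≡ 1ℤ
  ∑-subsets-≟ []              = refl
  ∑-subsets-≟ {suc n} (t ∷ T) = trans
    (∑-cartesianProductWith _∷_ (false ∷ true ∷ []) (subsets n)
      (λ S → ⟦ does (subset-≟ S (t ∷ T)) ⟧))
    (split t)
    where
    none : ∑ (subsets n) (λ _ → 0ℤ) ≡ 0ℤ
    none = trans (∑-const (subsets n) 0ℤ) (ℤ.*-zeroʳ (+ length (subsets n)))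

    split : ∀ t → ∑ (false ∷ true ∷ []) (λ s →
      ∑ (subsets n) λ S → ⟦ does (subset-≟ (s ∷ S) (t ∷ T)) ⟧) ≡ 1ℤ
    split false = cong₂ _+_ (∑-subsets-≟ T) (trans (ℤ.+-identityʳ _) none)
    split true  = cong₂ _+_ none (trans (ℤ.+-identityʳ _) (∑-subsets-≟ T))

  ∑≥ : (xs : List V) (f : V → ℤ) → (∀ x → 0ℤ ≤ f x) → ∀ {x} → x ∈ˡ xs → f x ≤ ∑ xs f
  ∑≥ (x ∷ xs) f 0≤f (here refl) =
    subst (_≤ f x + ∑ xs f) (ℤ.+-identityʳ (f x)) (ℤ.+-monoʳ-≤ (f x) (∑-nonneg xs 0≤f))
  ∑≥ (x ∷ xs) f 0≤f {y} (there y∈) =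
    subst (_≤ f x + ∑ xs f) (ℤ.+-identityˡ (f y)) (ℤ.+-mono-≤ (0≤f x) (∑≥ xs f 0≤f y∈))

  inducing : Graph k → Graph n → ℕ
  inducing {n = n} F G = length (filter (induces? F G) (subsets n))

  -- Double counting of pairs (`S`, `φ`): an inducing set has at least one isomorphism `φ`, and a
  -- tuple belongs only to its own image. Injectivity of `φ` is dropped on the right, which can only
  -- increase the count.
  inducing≤copies : (F : Graph k) (G : Graph n) →
    + inducing F G ≤ ∑ (tuples n k) λ φ → ⟦ does (F ≈? induced G (lookup φ)) ⟧
  inducing≤copies {k} {n} F G = begin
    + inducing F G
      ≡⟨ length-filter (induces? F G) (subsets n) ⟩
    ∑ (subsets n) (λ S → ⟦ does (induces? F G S) ⟧)
      ≤⟨ ∑-mono (subsets n) (λ S → ⟦does⟧≤ (induces? F G S)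
           (∑-nonneg (tuples n k) λ φ → 0≤⟦ isCopy S φ ⟧) (chosen S)) ⟩
    ∑ (subsets n) (λ S → ∑ (tuples n k) λ φ → ⟦ isCopy S φ ⟧)
      ≡⟨ ∑-swap (subsets n) (tuples n k) _ ⟩
    ∑ (tuples n k) (λ φ → ∑ (subsets n) λ S → ⟦ isCopy S φ ⟧)
      ≤⟨ ∑-mono (tuples n k) (λ φ → ∑-mono (subsets n) (copy-image φ)) ⟩
    ∑ (tuples n k) (λ φ → ∑ (subsets n) λ S → ⟦ matches φ ⟧ * ⟦ isImage φ S ⟧)
      ≡⟨ ∑-cong (tuples n k) (λ φ → trans
           (∑-*ˡ (subsets n) ⟦ matches φ ⟧ λ S → ⟦ isImage φ S ⟧)
           (trans (cong (_*_ ⟦ matches φ ⟧) (∑-subsets-≟ (image φ)))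
             (ℤ.*-identityʳ ⟦ matches φ ⟧))) ⟩
    ∑ (tuples n k) (λ φ → ⟦ matches φ ⟧)
      ∎
    where
    open ℤ.≤-Reasoning

    isCopy : Subset n → Vec (Fin n) k → Bool
    isCopy S φ = does (isCopy? F G S φ)

    matches : Vec (Fin n) k → Bool
    matches φ = does (F ≈? induced G (lookup φ))

    isImage : Vec (Fin n) k → Subset n → Bool
    isImage φ S = does (subset-≟ S (image φ))

    chosen : ∀ S → Induces F G S → 1ℤ ≤ ∑ (tuples n k) λ φ → ⟦ isCopy S φ ⟧
    chosen S (_ , φ , c) = subst (λ b → ⟦ b ⟧ ≤ ∑ (tuples n k) λ φ → ⟦ isCopy S φ ⟧)
      (dec-true (isCopy? F G S φ) c)
      (∑≥ (tuples n k) (λ φ → ⟦ isCopy S φ ⟧) (λ φ → 0≤⟦ isCopy S φ ⟧) (∈-vectors ∈-allFin φ))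

    copy-image : ∀ φ S → ⟦ isCopy S φ ⟧ ≤ ⟦ matches φ ⟧ * ⟦ isImage φ S ⟧
    copy-image φ S = ⟦does⟧≤ (isCopy? F G S φ)
      (0≤* 0≤⟦ matches φ ⟧ 0≤⟦ isImage φ S ⟧)
      λ c → ℤ.≤-reflexive (≡.sym (cong₂ (λ s t → ⟦ s ⟧ * ⟦ t ⟧)
        (dec-true (F ≈? induced G (lookup φ)) (proj₂ (proj₂ (proj₂ c))))
        (dec-true (subset-≟ S (image φ)) (copy⇒image {F = F} {G} {S} {φ} c))))

  -- Complete bipartite graphs

  ∑-lookup : (A : Subset n) → ∑ (allFin n) (λ v → ⟦ lookup A v ⟧) ≡ + ∣ A ∣
  ∑-lookup []                  = refl
  ∑-lookup {suc n} (true ∷ A)  = cong (_+_ 1ℤ)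
    (trans (∑-tabulate Fin.suc λ v → ⟦ lookup (true ∷ A) v ⟧) (∑-lookup A))
  ∑-lookup {suc n} (false ∷ A) = trans (ℤ.+-identityˡ _)
    (trans (∑-tabulate Fin.suc λ v → ⟦ lookup (false ∷ A) v ⟧) (∑-lookup A))

  ∑₄-product : (xs : List V) (f g h k : V → ℤ) →
               ∑₄ xs (λ a b c d → f a * (g b * (h c * k d)))
               ≡ ∑ xs f * (∑ xs g * (∑ xs h * ∑ xs k))
  ∑₄-product xs f g h k = trans (∑-cong xs λ a → trans (∑-cong xs λ b → trans
      (∑-cong xs λ c → trans (∑-*ˡ xs (f a) _) (cong (_*_ (f a))
        (trans (∑-*ˡ xs (g b) _) (cong (_*_ (g b)) (∑-*ˡ xs (h c) k)))))
      (trans (∑-*ˡ xs (f a) _) (cong (_*_ (f a)) (trans (∑-*ˡ xs (g b) _)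
        (cong (_*_ (g b)) (∑-*ʳ xs h (∑ xs k)))))))
      (trans (∑-*ˡ xs (f a) _) (cong (_*_ (f a)) (∑-*ʳ xs g _))))
    (∑-*ʳ xs f _)

  module _ {G : Graph n} (A : Subset n) (G-bip : IsBipartition G A) where

    private
      inA notA : Fin n → ℤ
      inA  v = ⟦ lookup A v ⟧
      notA v = ⟦ lookup (∁ A) v ⟧

    -- In a copy, `a`, `b` and `d` lie in one part and `c` in the other; the summands correspond to
    -- the two choices of the part. Each is a product of functions of single vertices, as
    -- `∑₄-product` requires.
    copy-bipartite : ∀ a b c d → copy (adj G) a b c d
      ≡ inA a * (inA b * (notA c * inA d)) + notA a * (notA b * (inA c * notA d))
    copy-bipartite a b c d
      rewrite G-bip a c | G-bip a b | G-bip a d | G-bip b d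
            | lookup-map a not A | lookup-map b not A | lookup-map c not A | lookup-map d not A
      with lookup A a | lookup A b | lookup A c | lookup A d
    ... | true  | true  | true  | true  = refl
    ... | true  | true  | true  | false = refl
    ... | true  | true  | false | true  = refl
    ... | true  | true  | false | false = refl
    ... | true  | false | true  | true  = refl
    ... | true  | false | true  | false = refl
    ... | true  | false | false | true  = refl
    ... | true  | false | false | false = refl
    ... | false | true  | true  | true  = refl
    ... | false | true  | true  | false = refl
    ... | false | true  | false | true  = refl
    ... | false | true  | false | false = refl
    ... | false | false | true  | true  = refl
    ... | false | false | true  | false = refl
    ... | false | false | false | true  = refl
    ... | false | false | false | false = refl

    parts : + n ≡ + ∣ A ∣ + + ∣ ∁ A ∣
    parts = cong +_ (≡.sym (trans (cong (ℕ._+_ ∣ A ∣) (∣∁p∣≡n∸∣p∣ A)) (ℕ.m+[n∸m]≡n (∣p∣≤n A))))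

    ∑₄-copy-bipartite : let x = + ∣ A ∣ ; y = + ∣ ∁ A ∣ in
      ∑₄ (allFin n) (copy (adj G)) ≡ x * (x * (y * x)) + y * (y * (x * y))
    ∑₄-copy-bipartite = begin
      ∑₄ vs (copy (adj G))
        ≡⟨ ∑₄-cong vs copy-bipartite ⟩
      ∑₄ vs (λ a b c d → inA a * (inA b * (notA c * inA d))
                          + notA a * (notA b * (inA c * notA d)))
        ≡⟨ ∑₄-+ vs _ _ ⟩
      ∑₄ vs (λ a b c d → inA a * (inA b * (notA c * inA d)))
        + ∑₄ vs (λ a b c d → notA a * (notA b * (inA c * notA d)))
        ≡⟨ cong₂ _+_ (∑₄-product vs inA inA notA inA) (∑₄-product vs notA notA inA notA) ⟩
      ∑ vs inA * (∑ vs inA * (∑ vs notA * ∑ vs inA))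
        + ∑ vs notA * (∑ vs notA * (∑ vs inA * ∑ vs notA))
        ≡⟨ cong₂ (λ x y → x * (x * (y * x)) + y * (y * (x * y))) (∑-lookup A) (∑-lookup (∁ A)) ⟩
      _ ∎
      where
      open ≡-Reasoning
      vs = allFin n

    -- For parts of sizes x and y this is (x + y)⁴ = 8 (x³y + xy³) + (x - y)⁴, with x - y written as
    -- 2x - n so that the error term depends on one part only.
    n⁴-bipartite : (+ n) ⁴ ≡ + 8 * ∑₄ (allFin n) (copy (adj G)) + (+ 2 * + ∣ A ∣ - + n) ⁴
    n⁴-bipartite = begin
      (+ n) ⁴
        ≡⟨ cong _⁴ parts ⟩
      (x + y) ⁴
        ≡⟨ identity x y ⟩
      + 8 * (x * (x * (y * x)) + y * (y * (x * y))) + (+ 2 * x - (x + y)) ⁴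
        ≡⟨ cong₂ (λ s m → + 8 * s + (+ 2 * x - m) ⁴) ∑₄-copy-bipartite parts ⟨
      + 8 * ∑₄ (allFin n) (copy (adj G)) + (+ 2 * x - + n) ⁴
        ∎
      where
      open ≡-Reasoning
      x = + ∣ A ∣
      y = + ∣ ∁ A ∣
      identity : ∀ x y → (x + y) * ((x + y) * ((x + y) * (x + y)))
        ≡ + 8 * (x * (x * (y * x)) + y * (y * (x * y)))
          + (+ 2 * x - (x + y)) * ((+ 2 * x - (x + y))
            * ((+ 2 * x - (x + y)) * (+ 2 * x - (x + y))))
      identity = solve-∀

module _ where

  open import Data.Integer.Tactic.RingSolver using (solve-∀)
  open import Data.Nat using (_+_; _*_; _^_; _≤_; ∣_-_∣; NonZero)
  open Certificate

  -- The deficit n⁴ - 8Λ in natural numbers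

  ∣pos-pos∣ : ∀ x y → ℤ.∣ + x ℤ.- + y ∣ ≡ ∣ x - y ∣
  ∣pos-pos∣ x y = trans (cong ℤ.∣_∣ (ℤ.m-n≡m⊖n x y)) ∣⊖∣
    where
    ∣⊖∣ : ℤ.∣ x ℤ.⊖ y ∣ ≡ ∣ x - y ∣
    ∣⊖∣ with ℕ.≤-total x y
    ... | inj₁ x≤y = trans (ℤ.∣⊖∣-≤ x≤y) (≡.sym (ℕ.m≤n⇒∣m-n∣≡n∸m x≤y))
    ... | inj₂ y≤x = trans (ℤ.∣m⊖n∣≡∣n⊖m∣ x y)
      (trans (ℤ.∣⊖∣-≤ y≤x) (≡.sym (ℕ.m≤n⇒∣n-m∣≡n∸m y≤x)))

  ⁴≡^4 : ∀ i → i ⁴ ≡ + (ℤ.∣ i ∣ ^ 4)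
  ⁴≡^4 i = trans (even i) (cong (λ x → + (∣i∣ * (∣i∣ * (∣i∣ * x)))) (≡.sym (ℕ.*-identityʳ ∣i∣)))
    where
    ∣i∣ = ℤ.∣ i ∣
    even : ∀ i → i ⁴ ≡ + (ℤ.∣ i ∣ * (ℤ.∣ i ∣ * (ℤ.∣ i ∣ * ℤ.∣ i ∣)))
    even (+ zero)  = refl
    even (+ suc m) = refl
    even -[1+ m ]  = refl

  -- The form is that of `_≍_`: along a sequence, `8Λ ≍ n⁴` unfolds to bounds
  -- `k * deficit G ≤ n ^ 4`. By `8Λ≤n⁴` the distance is n⁴ - 8Λ.
  deficit : Graph n → ℕ
  deficit {n} G = ∣ 8 * Λ H G - n ^ 4 ∣

  module _ {n} .{{_ : NonZero n}} (G : Graph n) where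

    private
      copies = ∑₄ (allFin n) (copy (adj G))

    -- The bound is exact, without error term: cancelling 1920 n in `0≤excess` bounds the number of
    -- copies, and embeddings are among the copies.
    8Λ≤n⁴ : 8 * Λ H G ≤ n ^ 4
    8Λ≤n⁴ = ℤ.drop‿+≤+ (begin
      + (8 * Λ H G)    ≡⟨ ℤ.pos-* 8 (Λ H G) ⟩
      + 8 ℤ.* + Λ H G  ≤⟨ ℤ.*-monoˡ-≤-nonNeg (+ 8) (Λ≤∑₄-copy G) ⟩
      + 8 ℤ.* copies   ≤⟨ ℤ.0≤i-j⇒j≤i (ℤ.*-cancelˡ-≤-pos 0ℤ _ (+ n) {{pos}} n*0≤) ⟩
      (+ n) ⁴          ≡⟨ ⁴≡^4 (+ n) ⟩
      + (n ^ 4)        ∎)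
      where
      open ℤ.≤-Reasoning
      pos : ℤ.Positive (+ n)
      pos = ℤ.positive (ℤ.+<+ (ℕ.>-nonZero⁻¹ n))

      n*0≤ : + n ℤ.* 0ℤ ℤ.≤ + n ℤ.* ((+ n) ⁴ ℤ.- + 8 ℤ.* copies)
      n*0≤ = subst (ℤ._≤ + n ℤ.* ((+ n) ⁴ ℤ.- + 8 ℤ.* copies)) (≡.sym (ℤ.*-zeroʳ (+ n)))
        (ℤ.*-cancelˡ-≤-pos 0ℤ _ (+ 1920) (0≤excess G))

    n⁴≡8Λ+deficit : n ^ 4 ≡ 8 * Λ H G + deficit G
    n⁴≡8Λ+deficit = trans (≡.sym (ℕ.m+[n∸m]≡n 8Λ≤n⁴))
      (cong (_+_ (8 * Λ H G)) (≡.sym (ℕ.m≤n⇒∣m-n∣≡n∸m 8Λ≤n⁴)))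

    deficit≤ : ∀ {x} → n ^ 4 ≤ 8 * Λ H G + x → deficit G ≤ x
    deficit≤ n⁴≤ = subst (_≤ _) (≡.sym (ℕ.m≤n⇒∣m-n∣≡n∸m 8Λ≤n⁴)) (ℕ.m≤n+o⇒m∸n≤o _ _ n⁴≤)

    -- Replacing the number of copies by the smaller `Λ` enlarges the bound of `copies≤excess`. A
    -- deficit of order o(n⁴) thus leaves only o(n⁵) sets inducing `F`.
    inducing≤deficit : (F : Graph 5) → 1ℤ ℤ.≤ symmetricSlack F →
                       inducing F G ≤ 1920 * (n * deficit G)
    inducing≤deficit F 1≤s = ℤ.drop‿+≤+ (begin
      + inducing F G
        ≤⟨ inducing≤copies F G ⟩
      _ ≤⟨ copies≤excess F 1≤s G ⟩
      + 1920 ℤ.* (+ n ℤ.* ((+ n) ⁴ ℤ.- + 8 ℤ.* copies))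
        ≤⟨ ℤ.*-monoˡ-≤-nonNeg (+ 1920) (ℤ.*-monoˡ-≤-nonNeg (+ n)
             (ℤ.+-monoʳ-≤ ((+ n) ⁴) (ℤ.neg-mono-≤ (ℤ.*-monoˡ-≤-nonNeg (+ 8) (Λ≤∑₄-copy G))))) ⟩
      + 1920 ℤ.* (+ n ℤ.* ((+ n) ⁴ ℤ.- + 8 ℤ.* + Λ H G))
        ≡⟨ cong (λ x → + 1920 ℤ.* (+ n ℤ.* x)) (≡.sym deficit-ℤ) ⟩
      + 1920 ℤ.* (+ n ℤ.* + deficit G)
        ≡⟨ cong (ℤ._*_ (+ 1920)) (ℤ.pos-* n (deficit G)) ⟨
      + 1920 ℤ.* + (n * deficit G)
        ≡⟨ ℤ.pos-* 1920 (n * deficit G) ⟨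
      + (1920 * (n * deficit G))
        ∎)
      where
      open ℤ.≤-Reasoning
      cancel : ∀ x y → x ≡ y ℤ.+ x ℤ.- y
      cancel = solve-∀

      deficit-ℤ : + deficit G ≡ (+ n) ⁴ ℤ.- + 8 ℤ.* + Λ H G
      deficit-ℤ = trans (cancel (+ deficit G) (+ (8 * Λ H G)))
        (cong₂ ℤ._-_ (trans (≡.sym (ℤ.pos-+ (8 * Λ H G) (deficit G)))
                     (trans (cong +_ (≡.sym n⁴≡8Λ+deficit)) (≡.sym (⁴≡^4 (+ n)))))
                   (ℤ.pos-* 8 (Λ H G)))

    -- The fourth power measures the imbalance of the parts; 24 n³ is 8 times the 3 n³ non-injective
    -- tuples allowed for in `∑₄-copy≤Λ`.
    deficit-bipartite : (A : Subset n) → IsBipartition G A →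
                        deficit G ≤ ∣ 2 * ∣ A ∣ - n ∣ ^ 4 + 24 * n ^ 3
    deficit-bipartite A G-bip = deficit≤ (ℤ.drop‿+≤+ (begin
      + (n ^ 4)
        ≡⟨ ⁴≡^4 (+ n) ⟨
      (+ n) ⁴
        ≡⟨ n⁴-bipartite {G = G} A G-bip ⟩
      + 8 ℤ.* copies ℤ.+ (+ 2 ℤ.* + ∣ A ∣ ℤ.- + n) ⁴
        ≤⟨ ℤ.+-monoˡ-≤ _ (ℤ.*-monoˡ-≤-nonNeg (+ 8) (∑₄-copy≤Λ G)) ⟩
      + 8 ℤ.* (+ Λ H G ℤ.+ + 3 ℤ.* (+ n ℤ.* (+ n ℤ.* + n))) ℤ.+ (+ 2 ℤ.* + ∣ A ∣ ℤ.- + n) ⁴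
        ≡⟨ regroup (+ Λ H G) (+ n ℤ.* (+ n ℤ.* + n)) ((+ 2 ℤ.* + ∣ A ∣ ℤ.- + n) ⁴) ⟩
      + 8 ℤ.* + Λ H G ℤ.+ ((+ 2 ℤ.* + ∣ A ∣ ℤ.- + n) ⁴ ℤ.+ + 24 ℤ.* (+ n ℤ.* (+ n ℤ.* + n)))
        ≡⟨ cong₂ ℤ._+_ (≡.sym (ℤ.pos-* 8 (Λ H G))) (cong₂ ℤ._+_ fourth cube) ⟩
      + (8 * Λ H G) ℤ.+ (+ (∣ 2 * ∣ A ∣ - n ∣ ^ 4) ℤ.+ + (24 * n ^ 3))
        ≡⟨ cong (ℤ._+_ (+ (8 * Λ H G))) (ℤ.pos-+ (∣ 2 * ∣ A ∣ - n ∣ ^ 4) (24 * n ^ 3)) ⟨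
      + (8 * Λ H G) ℤ.+ + (∣ 2 * ∣ A ∣ - n ∣ ^ 4 + 24 * n ^ 3)
        ≡⟨ ℤ.pos-+ (8 * Λ H G) _ ⟨
      + (8 * Λ H G + (∣ 2 * ∣ A ∣ - n ∣ ^ 4 + 24 * n ^ 3))
        ∎))
      where
      open ℤ.≤-Reasoning
      regroup : ∀ x y z → + 8 ℤ.* (x ℤ.+ + 3 ℤ.* y) ℤ.+ z ≡ + 8 ℤ.* x ℤ.+ (z ℤ.+ + 24 ℤ.* y)
      regroup = solve-∀

      fourth : (+ 2 ℤ.* + ∣ A ∣ ℤ.- + n) ⁴ ≡ + (∣ 2 * ∣ A ∣ - n ∣ ^ 4)
      fourth = trans (⁴≡^4 (+ 2 ℤ.* + ∣ A ∣ ℤ.- + n)) (cong (λ x → + (x ^ 4))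
        (trans (cong (λ x → ℤ.∣ x ℤ.- + n ∣) (≡.sym (ℤ.pos-* 2 ∣ A ∣)))
          (∣pos-pos∣ (2 * ∣ A ∣) n)))

      cube : + 24 ℤ.* (+ n ℤ.* (+ n ℤ.* + n)) ≡ + (24 * n ^ 3)
      cube = begin-equality
        + 24 ℤ.* (+ n ℤ.* (+ n ℤ.* + n))
          ≡⟨ cong (λ x → + 24 ℤ.* (+ n ℤ.* x)) (ℤ.pos-* n n) ⟨
        + 24 ℤ.* (+ n ℤ.* + (n * n))
          ≡⟨ cong (ℤ._*_ (+ 24)) (ℤ.pos-* n (n * n)) ⟨
        + 24 ℤ.* + (n * (n * n))
          ≡⟨ ℤ.pos-* 24 (n * (n * n)) ⟨
        + (24 * (n * (n * n)))
          ≡⟨ cong (λ x → + (24 * (n * (n * x)))) (ℕ.*-identityʳ n) ⟨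
        + (24 * n ^ 3)
          ∎

module _ where

  open import Data.Nat using (_+_; _*_; _^_; _⊔_; _!; _≤_; _<_; ∣_-_∣; NonZero; >-nonZero)
  open import Data.Nat.Combinatorics using (_P_; _C_; nCk≡nPk/k!)
  open import Data.Nat.Combinatorics.Specification using (k!∣nP′k)
  open import Data.Nat.DivMod using (m/n*n≡m)
  open import Data.Nat.Properties using (_!≢0)
  open import Data.Nat.Tactic.RingSolver using (solve-∀)
  open import Data.Rational as ℚ using (0ℚ; mkℚ; toℚᵘ)
  import Data.Rational.Properties as ℚ
  open import Data.Rational.Unnormalised as ℚᵘ using (ℚᵘ; mkℚᵘ; *≤*; *<*; _≃_)
  import Data.Rational.Unnormalised.Properties as ℚᵘ

  private
    variable
      a b c : ℕ → ℕ
      Φ Ψ : ℕ → Set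

  -- Limits

  Eventually : (ℕ → Set) → Set
  Eventually Φ = ∃ λ N → ∀ m → N ≤ m → Φ m

  ev-map : (∀ {m} → Φ m → Ψ m) → Eventually Φ → Eventually Ψ
  ev-map f (N , p) = N , λ m N≤m → f (p m N≤m)

  ev-zip : Eventually Φ → Eventually Ψ → Eventually (λ m → Φ m × Ψ m)
  ev-zip (M , p) (N , q) = M ⊔ N , λ m ≤m →
    p m (ℕ.m⊔n≤o⇒m≤o M N ≤m) , q m (ℕ.m⊔n≤o⇒n≤o M N ≤m)

  -- a / b tends to 1, without denominators.
  infix 4 _≍_

  _≍_ : (ℕ → ℕ) → (ℕ → ℕ) → Set
  a ≍ b = ∀ k → Eventually λ m → k * ∣ a m - b m ∣ ≤ b m

  module _ (a b d k : ℕ) where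

    private
      u v w : ℚᵘ
      u = mkℚᵘ (+ a) b
      v = mkℚᵘ (+ 1) d
      w = mkℚᵘ (+ 1) k

      distance : toℚᵘ ℚ.∣ a ÷ suc b ℚ.- 1 ÷ suc d ∣ ≃ ℚᵘ.∣ u ℚᵘ.- v ∣
      distance = begin
        toℚᵘ ℚ.∣ a ÷ suc b ℚ.- 1 ÷ suc d ∣
          ≈⟨ ℚ.toℚᵘ-homo-∣-∣ (a ÷ suc b ℚ.- 1 ÷ suc d) ⟩
        ℚᵘ.∣ toℚᵘ (a ÷ suc b ℚ.- 1 ÷ suc d) ∣
          ≈⟨ ℚᵘ.∣-∣-cong (ℚ.toℚᵘ-homo-+ (a ÷ suc b) (ℚ.- (1 ÷ suc d))) ⟩
        ℚᵘ.∣ toℚᵘ (a ÷ suc b) ℚᵘ.+ toℚᵘ (ℚ.- (1 ÷ suc d)) ∣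
          ≈⟨ ℚᵘ.∣-∣-cong (ℚᵘ.+-cong (ℚ.toℚᵘ-fromℚᵘ u)
               (ℚᵘ.≃-trans (ℚ.toℚᵘ-homo‿- (1 ÷ suc d)) (ℚᵘ.-‿cong (ℚ.toℚᵘ-fromℚᵘ v)))) ⟩
        ℚᵘ.∣ u ℚᵘ.- v ∣
          ∎
        where open ℚᵘ.≃-Reasoning

      numerator : ℤ.∣ + a ℤ.* + suc d ℤ.+ (ℤ.- + 1) ℤ.* + suc b ∣ ≡ ∣ a * suc d - suc b ∣
      numerator = trans (cong ℤ.∣_∣ (cong₂ ℤ._+_ (≡.sym (ℤ.pos-* a (suc d))) (ℤ.-1*i≡-i (+ suc b))))
        (∣pos-pos∣ (a * suc d) (suc b))

      lhs : + ℤ.∣ + a ℤ.* + suc d ℤ.+ (ℤ.- + 1) ℤ.* + suc b ∣ ℤ.* + suc k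
            ≡ + (suc k * ∣ a * suc d - suc b ∣)
      lhs = trans (cong (λ x → + x ℤ.* + suc k) numerator)
        (trans (≡.sym (ℤ.pos-* e (suc k))) (cong +_ (ℕ.*-comm e (suc k))))
        where e = ∣ a * suc d - suc b ∣

    -- The rational inequality is cross-multiplied among unnormalised rationals, where numerators
    -- and denominators stay explicit.
    ÷-close⁺ : suc k * ∣ a * suc d - suc b ∣ ≤ suc b * suc d →
               ℚ.∣ a ÷ suc b ℚ.- 1 ÷ suc d ∣ ℚ.≤ 1 ÷ suc k
    ÷-close⁺ le = ℚ.toℚᵘ-cancel-≤ (ℚᵘ.≤-respˡ-≃ (ℚᵘ.≃-sym distance)
      (ℚᵘ.≤-respʳ-≃ (ℚᵘ.≃-sym (ℚ.toℚᵘ-fromℚᵘ w)) (*≤* (subst₂ ℤ._≤_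
        (≡.sym lhs) (≡.sym (ℤ.*-identityˡ (+ (suc b * suc d)))) (+≤+ le)))))

    ÷-close⁻ : ℚ.∣ a ÷ suc b ℚ.- 1 ÷ suc d ∣ ℚ.≤ 1 ÷ suc k →
               suc k * ∣ a * suc d - suc b ∣ ≤ suc b * suc d
    ÷-close⁻ le with ℚᵘ.≤-respˡ-≃ distance (ℚᵘ.≤-respʳ-≃ (ℚ.toℚᵘ-fromℚᵘ w) (ℚ.toℚᵘ-mono-≤ le))
    ... | *≤* le′ = ℤ.drop‿+≤+ (subst₂ ℤ._≤_ lhs (ℤ.*-identityˡ (+ (suc b * suc d))) le′)

  0<÷ : ∀ k → 0ℚ ℚ.< 1 ÷ suc k
  0<÷ k = ℚ.toℚᵘ-cancel-< (ℚᵘ.<-respʳ-≃ (ℚᵘ.≃-sym (ℚ.toℚᵘ-fromℚᵘ (mkℚᵘ (+ 1) k)))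
    (*<* (ℤ.+<+ (s≤s z≤n))))

  ÷<-archimedean : ∀ ε → 0ℚ ℚ.< ε → ∃ λ k → 1 ÷ suc k ℚ.< ε
  ÷<-archimedean (mkℚ (+ zero)  q _) (ℚ.*<* (ℤ.+<+ ()))
  ÷<-archimedean (mkℚ (ℤ.-[1+ _ ]) q _) (ℚ.*<* ())
  -- The denominator of ε is `suc q`; the reciprocal of the next integer is strictly below ε.
  ÷<-archimedean (mkℚ (+ suc p) q _) _ = suc q ,
    ℚ.toℚᵘ-cancel-< (ℚᵘ.<-respˡ-≃ (ℚᵘ.≃-sym (ℚ.toℚᵘ-fromℚᵘ (mkℚᵘ (+ 1) (suc q))))
      (*<* (ℤ.+<+ (s≤s (s≤s (ℕ.+-monoʳ-≤ q z≤n))))))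

  ÷⟶⇒≍ : ∀ d → Eventually (λ m → 0 < b m) →
         (λ m → a m ÷ b m) ⟶ 1 ÷ suc d → (λ m → a m * suc d) ≍ b
  ÷⟶⇒≍ {b} {a} d 0<b lim k = ev-map (λ {m} (pos , lt) → close m pos lt)
    -- A tolerance of 1/(k (d + 1)) would do; the successor covers k = 0.
    (ev-zip 0<b (lim (1 ÷ suc (k * suc d)) (0<÷ (k * suc d))))
    where
    close : ∀ m → 0 < b m → ℚ.∣ a m ÷ b m ℚ.- 1 ÷ suc d ∣ ℚ.< 1 ÷ suc (k * suc d) →
            k * ∣ a m * suc d - b m ∣ ≤ b m
    close m pos lt with b m
    ... | suc b′ = ℕ.*-cancelʳ-≤ _ _ (suc d) (begin
      k * e * suc d        ≡⟨ comm k e (suc d) ⟩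
      k * suc d * e        ≤⟨ ℕ.m≤n+m _ e ⟩
      suc (k * suc d) * e  ≤⟨ ÷-close⁻ (a m) b′ d (k * suc d) (ℚ.<⇒≤ lt) ⟩
      suc b′ * suc d       ∎)
      where
      open ℕ.≤-Reasoning
      e = ∣ a m * suc d - suc b′ ∣
      comm : ∀ x y z → x * y * z ≡ x * z * y
      comm = solve-∀

  ≍⇒÷⟶ : ∀ d → Eventually (λ m → 0 < b m) →
         (λ m → a m * suc d) ≍ b → (λ m → a m ÷ b m) ⟶ 1 ÷ suc d
  ≍⇒÷⟶ {b} {a} d 0<b a≍b ε 0<ε with ÷<-archimedean ε 0<ε
  ... | k , 1/k<ε = ev-map (λ {m} (pos , le) → close m pos le) (ev-zip 0<b (a≍b (suc k)))
    where
    close : ∀ m → 0 < b m → suc k * ∣ a m * suc d - b m ∣ ≤ b m →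
            ℚ.∣ a m ÷ b m ℚ.- 1 ÷ suc d ∣ ℚ.< ε
    close m pos le with b m
    ... | suc b′ = ℚ.≤-<-trans
      (÷-close⁺ (a m) b′ d k (ℕ.≤-trans le (ℕ.m≤m*n (suc b′) (suc d)))) 1/k<ε

  ≍-cong : (∀ m → a m ≡ c m) → a ≍ b → c ≍ b
  ≍-cong {b = b} a≗c a≍b k = ev-map (λ {m} → subst (λ x → k * ∣ x - b m ∣ ≤ b m) (a≗c m)) (a≍b k)

  -- The hypothesis at k + 1 provides one spare distance, which pays for replacing y by x on the
  -- right.
  ≍-sym : a ≍ b → b ≍ a
  ≍-sym {a} {b} a≍b k = ev-map (λ {m} → flip (a m) (b m)) (a≍b (suc k))
    where
    flip : ∀ x y → suc k * ∣ x - y ∣ ≤ y → k * ∣ y - x ∣ ≤ x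
    flip x y le = ℕ.+-cancelˡ-≤ ∣ x - y ∣ _ _ (begin
      ∣ x - y ∣ + k * ∣ y - x ∣ ≡⟨ cong (λ e → ∣ x - y ∣ + k * e) (ℕ.∣-∣-comm y x) ⟩
      suc k * ∣ x - y ∣         ≤⟨ le ⟩
      y                         ≤⟨ ℕ.m≤n+∣n-m∣ y x ⟩
      x + ∣ x - y ∣             ≡⟨ ℕ.+-comm x _ ⟩
      ∣ x - y ∣ + x             ∎)
      where open ℕ.≤-Reasoning

  ≍-trans : a ≍ b → b ≍ c → a ≍ c
  ≍-trans {a} {b} {c} a≍b b≍c k =
    ev-map (λ {m} (p , q) → chain (a m) (b m) (c m) p q)
      -- The first bound gives y, at most |y - z| + z; the extra 1 in the second absorbs this |y -
      -- z|. The total 2z stays within 3z.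
      (ev-zip (a≍b (3 * k)) (b≍c (suc (3 * k))))
    where
    chain : ∀ x y z → 3 * k * ∣ x - y ∣ ≤ y → suc (3 * k) * ∣ y - z ∣ ≤ z → k * ∣ x - z ∣ ≤ z
    chain x y z p q = ℕ.*-cancelˡ-≤ 3 (begin
      3 * (k * ∣ x - z ∣)
        ≡⟨ ℕ.*-assoc 3 k _ ⟨
      3 * k * ∣ x - z ∣
        ≤⟨ ℕ.*-monoʳ-≤ (3 * k) (ℕ.∣-∣-triangle x y z) ⟩
      3 * k * (∣ x - y ∣ + ∣ y - z ∣)
        ≡⟨ ℕ.*-distribˡ-+ (3 * k) ∣ x - y ∣ ∣ y - z ∣ ⟩
      3 * k * ∣ x - y ∣ + 3 * k * ∣ y - z ∣
        ≤⟨ ℕ.+-monoˡ-≤ _ p ⟩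
      y + 3 * k * ∣ y - z ∣
        ≤⟨ ℕ.+-monoˡ-≤ _ (ℕ.m≤∣m-n∣+n y z) ⟩
      ∣ y - z ∣ + z + 3 * k * ∣ y - z ∣
        ≡⟨ regroup ∣ y - z ∣ z (3 * k * ∣ y - z ∣) ⟩
      suc (3 * k) * ∣ y - z ∣ + z
        ≤⟨ ℕ.+-monoˡ-≤ z q ⟩
      z + z
        ≤⟨ ℕ.m≤m+n (z + z) z ⟩
      z + z + z
        ≡⟨ three z ⟩
      3 * z
        ∎)
      where
      open ℕ.≤-Reasoning
      regroup : ∀ e z f → e + z + f ≡ e + f + z
      regroup = solve-∀
      three : ∀ z → z + z + z ≡ 3 * z
      three = solve-∀

  -- Falling factorials compared with powers

  n⁴≡nP4 : ∀ m → let n = 4 + m in n ^ 4 ≡ n P 4 + (6 * m * m * m + 61 * m * m + 206 * m + 232)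
  n⁴≡nP4 = identity
    where
    identity : ∀ m → (4 + m) * ((4 + m) * ((4 + m) * ((4 + m) * 1)))
      ≡ (1 + m) * ((2 + m) * ((3 + m) * ((4 + m) * 1)))
        + (6 * m * m * m + 61 * m * m + 206 * m + 232)
    identity = solve-∀

  nP4-close : ∀ n → 4 ≤ n → ∣ n P 4 - n ^ 4 ∣ ≤ 6 * n ^ 3
  nP4-close (suc (suc (suc (suc m)))) (s≤s (s≤s (s≤s (s≤s _)))) = begin
    ∣ (4 + m) P 4 - (4 + m) ^ 4 ∣
      ≡⟨ cong (λ x → ∣ (4 + m) P 4 - x ∣) (n⁴≡nP4 m) ⟩
    ∣ (4 + m) P 4 - (4 + m) P 4 + gap ∣
      ≡⟨ ℕ.∣m-m+n∣≡n ((4 + m) P 4) gap ⟩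
    gap
      -- The added polynomial is 6 n³ - `gap`, expanded at n = 4 + m; with this substitution `n P 4`
      -- computes to a product.
      ≤⟨ ℕ.m≤m+n gap (11 * m * m + 82 * m + 152) ⟩
    gap + (11 * m * m + 82 * m + 152)
      ≡⟨ identity m ⟩
    6 * (4 + m) ^ 3
      ∎
    where
    open ℕ.≤-Reasoning
    gap = 6 * m * m * m + 61 * m * m + 206 * m + 232
    identity : ∀ m → 6 * m * m * m + 61 * m * m + 206 * m + 232 + (11 * m * m + 82 * m + 152)
      ≡ 6 * ((4 + m) * ((4 + m) * ((4 + m) * 1)))
    identity = solve-∀

  n⁵≤nP5 : ∀ n → 5 ≤ n → n ^ 5 ≤ n P 5 + 10 * n ^ 4
  n⁵≤nP5 (suc (suc (suc (suc (suc m))))) (s≤s (s≤s (s≤s (s≤s (s≤s _))))) = ℕ.≤-trans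
    (ℕ.m≤m+n _ (35 * m * m * m + 475 * m * m + 2149 * m + 3245)) (ℕ.≤-reflexive (identity m))
    where
    identity : ∀ m → (5 + m) * ((5 + m) * ((5 + m) * ((5 + m) * ((5 + m) * 1))))
      + (35 * m * m * m + 475 * m * m + 2149 * m + 3245)
      ≡ (1 + m) * ((2 + m) * ((3 + m) * ((4 + m) * ((5 + m) * 1))))
      + 10 * ((5 + m) * ((5 + m) * ((5 + m) * ((5 + m) * 1))))
    identity = solve-∀

  4≤n⇒0<nP4 : ∀ n → 4 ≤ n → 0 < n P 4
  4≤n⇒0<nP4 (suc (suc (suc (suc m)))) (s≤s (s≤s (s≤s (s≤s _)))) = s≤s z≤n

  -- Graphs with the most embeddings

  Λ-cong : (H : ColouredGraph κ) {G K : Graph n} → G ≈ K → Λ H G ≡ Λ H K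
  Λ-cong {κ} {n} H {G} {K} G≈K = cong length
    (filter-≐ (isEmbedding? H G) (isEmbedding? H K) ((λ {φ} → transport {G} {K} G≈K {φ})
      , λ {φ} → transport {K} {G} (λ u v → ≡.sym (G≈K u v)) {φ}) (tuples n κ))
    where
    transport : ∀ {G K : Graph n} → G ≈ K → ∀ {φ} → IsEmbedding H G φ → IsEmbedding H K φ
    transport G≈K (inj , red⇒ , blue⇒) = inj
      , (λ i j e → trans (≡.sym (G≈K _ _)) (red⇒ i j e))
      , (λ i j e → trans (≡.sym (G≈K _ _)) (blue⇒ i j e))

  ÷-monoˡ : ∀ {x y} b → x ≤ y → x ÷ b ℚ.≤ y ÷ b
  ÷-monoˡ zero    x≤y = ℚ.≤-refl
  ÷-monoˡ {x} {y} (suc b) x≤y = ℚ.toℚᵘ-cancel-≤ (ℚᵘ.≤-respˡ-≃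
    (ℚᵘ.≃-sym (ℚ.toℚᵘ-fromℚᵘ (mkℚᵘ (+ x) b)))
    (ℚᵘ.≤-respʳ-≃ (ℚᵘ.≃-sym (ℚ.toℚᵘ-fromℚᵘ (mkℚᵘ (+ y) b)))
      (*≤* (ℤ.*-monoʳ-≤-nonNeg (+ suc b) (+≤+ x≤y)))))

  module _ (H : ColouredGraph κ) where

    -- The edgeless graph `bipartite ⊥` is the default that `argmax` asks for.
    maximiser : ∀ n → Graph n
    maximiser n = argmax (Λ H) (bipartite ⊥) (graphs n)

    Λ≤Λ-maximiser : (G : Graph n) → Λ H G ≤ Λ H (maximiser n)
    Λ≤Λ-maximiser {n} G =
      let K , K∈ , G≈K = graphs-complete G in
      subst (_≤ Λ H (maximiser n)) (≡.sym (Λ-cong H {G} {K} G≈K))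
        (All.lookup (f[xs]≤f[argmax] {f = Λ H} (bipartite ⊥) (graphs n)) K∈)

  -- Densities along sequences of graphs

  module _ (n : ℕ → ℕ) (G : ∀ m → Graph (n m)) (large : n ⟶∞) where

    0<nP4 : Eventually λ m → 0 < n m P 4
    0<nP4 = ev-map (λ {m} → 4≤n⇒0<nP4 (n m)) (large 4)

    nP4≍n⁴ : (λ m → n m P 4) ≍ (λ m → n m ^ 4)
    nP4≍n⁴ k = ev-map (λ {m} (4≤n , 6k≤n) → begin
      k * ∣ n m P 4 - n m ^ 4 ∣ ≤⟨ ℕ.*-monoʳ-≤ k (nP4-close (n m) 4≤n) ⟩
      k * (6 * n m ^ 3)         ≡⟨ ℕ.*-assoc k 6 _ ⟨
      k * 6 * n m ^ 3           ≤⟨ ℕ.*-monoˡ-≤ (n m ^ 3) 6k≤n ⟩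
      n m ^ 4                   ∎)
      (ev-zip (large 4) (large (k * 6)))
      where open ℕ.≤-Reasoning

    private
      Λs 8Λ nP4 n⁴ : ℕ → ℕ
      Λs  m = Λ H (G m)
      8Λ  m = 8 * Λ H (G m)
      nP4 m = n m P 4
      n⁴  m = n m ^ 4

    density⟶⇒≍ : (λ m → density H (G m)) ⟶ (+ 1 / 8) → 8Λ ≍ n⁴
    density⟶⇒≍ lim = ≍-trans {8Λ} {nP4} {n⁴}
      -- The argument 7 stands for the denominator `suc 7` of 1/8.
      (≍-cong {b = nP4} (λ m → ℕ.*-comm (Λs m) 8) (÷⟶⇒≍ {nP4} {Λs} 7 0<nP4 lim)) nP4≍n⁴

    ≍⇒density⟶ : 8Λ ≍ n⁴ → (λ m → density H (G m)) ⟶ (+ 1 / 8)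
    ≍⇒density⟶ 8Λ≍n⁴ = ≍⇒÷⟶ {nP4} {Λs} 7 0<nP4 (≍-cong {b = nP4} (λ m → ℕ.*-comm 8 (Λs m))
      (≍-trans {8Λ} {n⁴} {nP4} 8Λ≍n⁴ (≍-sym {nP4} {n⁴} nP4≍n⁴)))

    balanced-bipartite : (A : ∀ m → Subset (n m)) → (∀ m → IsBipartition (G m) (A m)) →
      (λ m → 2 * ∣ A m ∣) ≍ n → 8Λ ≍ n⁴
    balanced-bipartite A bip 2A≍n k =
      ev-map (λ {m} (K≤n , le) → bound k m K≤n le)
        -- Each of the two error terms gets half of n⁴. With e the imbalance, (2k + 1) e ≤ n gives
        -- both 2k e ≤ n and e ≤ n; the successor in the first constant makes n positive.
        (ev-zip (large (suc (2 * k * 24))) (2A≍n (suc (2 * k))))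
      where
      open ℕ.≤-Reasoning
      bound : ∀ k m → suc (2 * k * 24) ≤ n m →
              suc (2 * k) * ∣ 2 * ∣ A m ∣ - n m ∣ ≤ n m → k * deficit (G m) ≤ n m ^ 4
      bound k m K≤n le = ℕ.*-cancelˡ-≤ 2 (begin
        2 * (k * deficit (G m))
          ≤⟨ ℕ.*-monoʳ-≤ 2 (ℕ.*-monoʳ-≤ k
               (deficit-bipartite {{>-nonZero (ℕ.≤-trans (s≤s z≤n) K≤n)}} (G m) (A m) (bip m))) ⟩
        2 * (k * (e ^ 4 + 24 * x ^ 3))
          ≡⟨ regroup k e (e ^ 3) (x ^ 3) ⟩
        2 * k * e * e ^ 3 + 2 * k * 24 * x ^ 3
          ≤⟨ ℕ.+-mono-≤
               (ℕ.*-mono-≤ (ℕ.m+n≤o⇒n≤o e le) (ℕ.^-monoˡ-≤ 3 (ℕ.m+n≤o⇒m≤o e le)))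
               (ℕ.*-monoˡ-≤ (x ^ 3) (ℕ.<⇒≤ K≤n)) ⟩
        x * x ^ 3 + x * x ^ 3
          ≡⟨ cong (_+_ (x ^ 4)) (ℕ.+-identityʳ (x ^ 4)) ⟨
        2 * x ^ 4
          ∎)
        where
        x = n m
        e = ∣ 2 * ∣ A m ∣ - x ∣
        regroup : ∀ k e y z → 2 * (k * (e * y + 24 * z)) ≡ 2 * k * e * y + 2 * k * 24 * z
        regroup = solve-∀

  half : ∀ n → Subset n
  half zero          = []
  half (suc zero)    = false ∷ []
  half (suc (suc n)) = true ∷ false ∷ half n

  ∣half∣ : ∀ n → ∣ 2 * ∣ half n ∣ - n ∣ ≤ 1
  ∣half∣ zero          = z≤n
  ∣half∣ (suc zero)    = s≤s z≤n
  ∣half∣ (suc (suc n)) = subst (λ x → ∣ x - 2 + n ∣ ≤ 1) (≡.sym (ℕ.*-suc 2 ∣ half n ∣)) (∣half∣ n)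

  2half≍id : (λ m → 2 * ∣ half m ∣) ≍ (λ m → m)
  2half≍id k = k , λ m k≤m →
    ℕ.≤-trans (ℕ.*-monoʳ-≤ k (∣half∣ m)) (subst (_≤ m) (≡.sym (ℕ.*-identityʳ k)) k≤m)

  -- Since 8Λ never exceeds n⁴, more embeddings mean a smaller deficit. Maximisers therefore inherit
  -- convergence from the balanced complete bipartite graphs.
  limit-density : IsLimitDensity H (+ 1 / 8)
  limit-density = (λ n → density H (maximiser H n))
    , (λ n → (maximiser H n , refl) , λ G → ÷-monoˡ (n P 4) (Λ≤Λ-maximiser H G))
    , ≍⇒density⟶ (λ m → m) (maximiser H) id∞ λ k →
        ev-map (λ {m} (1≤m , le) → ℕ.≤-trans (ℕ.*-monoʳ-≤ k (improve m 1≤m)) le)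
          (ev-zip (1 , λ m 1≤m → 1≤m)
            (balanced-bipartite (λ m → m) (λ m → bipartite (half m)) id∞
              half (λ m u v → refl) 2half≍id k))
    where
    id∞ : (λ m → m) ⟶∞
    id∞ M = M , λ m M≤m → M≤m

    improve : ∀ m → 1 ≤ m → deficit (maximiser H m) ≤ deficit (bipartite (half m))
    improve m@(suc _) _ = deficit≤ (maximiser H m) (subst (_≤ 8 * Λ H (maximiser H m) + deficit B)
      (≡.sym (n⁴≡8Λ+deficit B))
      (ℕ.+-monoˡ-≤ (deficit B) (ℕ.*-monoʳ-≤ 8 (Λ≤Λ-maximiser H B))))
      where B = bipartite (half m)

  -- Vanishing of the non-extremal densities

  ≤÷⇒≤ : ∀ k x y → 1 ÷ suc k ℚ.≤ x ÷ y → y ≤ suc k * x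
  ≤÷⇒≤ k x zero    le = z≤n
  ≤÷⇒≤ k x (suc y) le with ℚᵘ.≤-respˡ-≃ (ℚ.toℚᵘ-fromℚᵘ (mkℚᵘ (+ 1) k))
    (ℚᵘ.≤-respʳ-≃ (ℚ.toℚᵘ-fromℚᵘ (mkℚᵘ (+ x) y)) (ℚ.toℚᵘ-mono-≤ le))
  ... | *≤* le′ = subst (suc y ≤_) (ℕ.*-comm x (suc k)) (ℤ.drop‿+≤+ (subst₂ ℤ._≤_
    (ℤ.*-identityˡ (+ suc y)) (≡.sym (ℤ.pos-* x (suc k))) le′))

  nP5≡nC5*120 : ∀ n → 5 ≤ n → n P 5 ≡ (n C 5) * 120
  nP5≡nC5*120 n 5≤n@(s≤s (s≤s (s≤s (s≤s (s≤s _))))) = ≡.sym (trans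
    (cong (_* 5 !) (nCk≡nPk/k! {5} {n} 5≤n))
    (m/n*n≡m {n P 5} {5 !} {{5 !≢0}} (k!∣nP′k {n} {5} 5≤n)))

  -- For n ≥ 20 the error 10 n⁴ in `n⁵≤nP5` is at most half of n⁵, so n⁵ is at most twice the
  -- falling factorial; 240 is 2 · 5!.
  n⁵≤240nC5 : ∀ n → 20 ≤ n → n ^ 5 ≤ 240 * (n C 5)
  n⁵≤240nC5 n 20≤n = ℕ.+-cancelʳ-≤ (n ^ 5) _ _ (begin
    n ^ 5 + n ^ 5
      ≡⟨ cong (_+_ (n ^ 5)) (ℕ.+-identityʳ (n ^ 5)) ⟨
    2 * n ^ 5
      ≤⟨ ℕ.*-monoʳ-≤ 2 (n⁵≤nP5 n 5≤n) ⟩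
    2 * (n P 5 + 10 * n ^ 4)
      ≡⟨ cong (λ x → 2 * (x + 10 * n ^ 4)) (nP5≡nC5*120 n 5≤n) ⟩
    2 * ((n C 5) * 120 + 10 * n ^ 4)
      ≡⟨ regroup (n C 5) (n ^ 4) ⟩
    240 * (n C 5) + 20 * n ^ 4
      ≤⟨ ℕ.+-monoʳ-≤ (240 * (n C 5)) (ℕ.*-monoˡ-≤ (n ^ 4) 20≤n) ⟩
    240 * (n C 5) + n ^ 5
      ∎)
    where
    open ℕ.≤-Reasoning
    5≤n : 5 ≤ n
    5≤n = ℕ.≤-trans (ℕ.≤ᵇ⇒≤ 5 20 _) 20≤n
    regroup : ∀ c x → 2 * (c * 120 + 10 * x) ≡ 240 * c + 20 * x
    regroup = solve-∀

  extremal⇒conclusion : (F : Graph 5) → Extremal F →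
    CompleteBipartite F ⊎ Σ (Graph 4) (λ B → CompleteBipartite B × F ≅ addIsolated B)
  extremal⇒conclusion F (inj₁ bip)          = inj₁ bip
  extremal⇒conclusion F (inj₂ (v , A , eq)) =
    inj₂ (bipartite A , (A , λ u w → refl) , transpose zero v , eq)

  -- A density bounded below means a number of inducing sets of order n⁵, whereas `inducing≤deficit`
  -- allows 1920 n times the deficit. Cancelling n makes the deficit of order n⁴.
  bounded-below⇒n⁴≤ : (F : Graph 5) → 1ℤ ℤ.≤ symmetricSlack F → (G : Graph n) → 20 ≤ n →
    ∀ k → 1 ÷ suc k ℚ.≤ p F G → n ^ 4 ≤ 240 * (suc k * 1920) * deficit G
  bounded-below⇒n⁴≤ {n} F 1≤s G 20≤n k 1/k≤p = ℕ.*-cancelˡ-≤ n (begin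
    n ^ 5
      ≤⟨ n⁵≤240nC5 n 20≤n ⟩
    240 * (n C 5)
      ≤⟨ ℕ.*-monoʳ-≤ 240 (≤÷⇒≤ k (inducing F G) (n C 5) 1/k≤p) ⟩
    240 * (suc k * inducing F G)
      ≤⟨ ℕ.*-monoʳ-≤ 240 (ℕ.*-monoʳ-≤ (suc k) (inducing≤deficit G F 1≤s)) ⟩
    240 * (suc k * (1920 * (n * deficit G)))
      ≡⟨ regroup (suc k) n (deficit G) ⟩
    n * (240 * (suc k * 1920) * deficit G)
      ∎)
    where
    open ℕ.≤-Reasoning
    instance
      n≢0 : NonZero n
      n≢0 = >-nonZero (ℕ.≤-trans (s≤s z≤n) 20≤n)
    regroup : ∀ k x y → 240 * (k * (1920 * (x * y))) ≡ x * (240 * (k * 1920) * y)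
    regroup = solve-∀

  vanishing : (n : ℕ → ℕ) (G : ∀ m → Graph (n m)) → n ⟶∞ →
    (λ m → 8 * Λ H (G m)) ≍ (λ m → n m ^ 4) →
    (F : Graph 5) → 1ℤ ℤ.≤ symmetricSlack F → ¬ EventuallyBoundedBelow (λ m → p F (G m))
  vanishing n G large 8Λ≍n⁴ F 1≤s (c , 0<c , bounded) =
    let k , 1/k<c = ÷<-archimedean c 0<c
        -- With M = 240 · 1920 (k + 1) and deficit D, a single index is enough: n⁴ ≤ M D and (M + 1)
        -- D ≤ n⁴ force D = 0, and then n⁴ ≤ 0.
        N , facts = ev-zip (large 20) (ev-zip bounded (8Λ≍n⁴ (suc (240 * (suc k * 1920)))))
        20≤n , c≤p , small = facts N ℕ.≤-refl
    in impossible (n N) (240 * (suc k * 1920)) (deficit (G N)) 20≤n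
         (bounded-below⇒n⁴≤ F 1≤s (G N) 20≤n k (ℚ.≤-trans (ℚ.<⇒≤ 1/k<c) c≤p)) small
    where
    impossible : ∀ x M D → 20 ≤ x → x ^ 4 ≤ M * D → ¬ suc M * D ≤ x ^ 4
    impossible x@(suc _) M D _ upper lower =
      ℕ.<⇒≱ (ℕ.m^n>0 x 4) (subst (x ^ 4 ≤_) (trans (cong (M *_) D≡0) (ℕ.*-zeroʳ M)) upper)
      where
      D≡0 : D ≡ 0
      D≡0 = ℕ.n≤0⇒n≡0 (ℕ.+-cancelʳ-≤ (M * D) D 0 (ℕ.≤-trans lower upper))

theorem3p13 : IsLimitDensity H (+ 1 / 8)
    × ((order : ℕ → ℕ) (G : ∀ m → Graph (order m)) (A : ∀ m → Subset (order m)) →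
    order ⟶∞ →
    (∀ m → IsBipartition (G m) (A m)) →
    (λ m → ∣ A m ∣ ÷ order m) ⟶ ½ →
    (λ m → ∣ ∁ (A m) ∣ ÷ order m) ⟶ ½ →
    (λ m → density H (G m)) ⟶ (+ 1 / 8))
    × ((order : ℕ → ℕ) (G : ∀ m → Graph (order m)) →
    order ⟶∞ →
    (λ m → density H (G m)) ⟶ (+ 1 / 8) →
    (F : Graph 5) →
    EventuallyBoundedBelow (λ m → p F (G m)) →
    CompleteBipartite F
    ⊎ Σ (Graph 4) (λ B → CompleteBipartite B × F ≅ addIsolated B))
theorem3p13 = limit-density
  , (λ order G A large bip A→½ _ → ≍⇒density⟶ order G large
      (balanced-bipartite order G large A bip
        (≍-cong {b = order} (λ m → ℕ.*-comm ∣ A m ∣ 2)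
          (÷⟶⇒≍ {order} {λ m → ∣ A m ∣} 1 (large 1) A→½))))
  , λ order G large lim F bounded → case classified F of λ where
      (inj₁ 1≤s)       → contradiction bounded
        (vanishing order G large (density⟶⇒≍ order G large lim) F 1≤s)
      (inj₂ (_ , ext)) → extremal⇒conclusion F ext
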